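{- Let $q,d\geq 2$ be coprime integers. Suppose that for every $\mathbf{s}\in\mathbb{Z}^5$ the density $\delta(q,d;\mathbf{s})$ exists. Then for every $\theta_w,x\in\mathbb{Z}/d\mathbb{Z}$ and every unit $\theta_u$ of $\mathbb{Z}/d\mathbb{Z}$, $$\delta(q,d;\theta_u,\theta_w,0,0,x)=\frac{1}{d}.$$ In particular, the map $n\mapsto u_q(n)$ is uniformly distributed modulo $d$ (every residue class modulo $d$ is attained by $u_q(n)$ on a set of $n$ of natural density $1/d$).
   Context: For an integer $q\geq 2$ and $n\in\mathbb{N}$: $v_q(0)=0$ and, for $n>0$, $v_q(n)=\max\{k: q^k\mid n\}$; $w_q(n)=\sum_{i=0}^n v_q(i)$; $u_q(n)=\sum_{i=0}^n w_q(i)$. For $\mathbf{s}=(\theta_u,\theta_w,\theta_2,\theta_1,\theta_0)$ with entries in $\mathbb{Z}$ or $\mathbb{Z}/d\mathbb{Z}$, $\gamma(A,q,d;\mathbf{s})$ is the number of $n\in\mathbb{N}$, $n<A$, with $\theta_u u_q(n)+\theta_w w_q(n)+\theta_2\frac{n(n+1)}{2}+\theta_1 n+\theta_0\equiv 0\pmod d$, and $\delta(q,d;\mathbf{s})=\lim_{N\to\infty}\gamma(N,q,d;\mathbf{s})/N$ (when the limit exists). -}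

module Defs where

open import Data.Empty using (⊥-elim)
open import Data.Integer.Base as ℤ using (ℤ; +_)
open import Data.Integer.Divisibility.Signed using (_∣_; _∣?_)
open import Data.List.Base using (length; filter; map; upTo)
open import Data.Nat.Base as ℕ using (ℕ; zero; suc; NonZero; z≤n; s≤s)
import Data.Nat.Divisibility as ℕ
import Data.Nat.DivMod as ℕ
open import Data.Nat.ListAction using (sum)
import Data.Nat.Properties as ℕ
open import Data.Product.Base using (∃-syntax; _×_; _,_)
open import Data.Rational.Base as ℚ
  using (ℚ; 0ℚ; 1ℚ; ½; _+_; _-_; -_; _*_; _<_; _≤_; ∣_∣; _/_)
open import Data.Rational.Properties as ℚ using ()
open import Data.Rational.Solver using (module +-*-Solver)
open import Data.Sum.Base using (inj₁; inj₂)
open import Level using (0ℓ)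
open import Relation.Binary.PropositionalEquality
  using (_≡_; refl; sym; cong; subst)
open import Relation.Nullary using (Dec; yes; no)
open import Relation.Unary using (Pred; Decidable)

IsCauchy : (ℕ → ℚ) → Set
IsCauchy a = ∀ (ε : ℚ) → 0ℚ < ε →
  ∃[ M ] (∀ m n → M ℕ.≤ m → M ℕ.≤ n → ∣ a m - a n ∣ < ε)

-- Cauchy reals.  No quotient is taken: different sequences may represent
-- the same real number, and limits are only determined up to that.
record ℝ : Set where
  constructor mkℝ
  field
    approx : ℕ → ℚ
    cauchy : IsCauchy approx

open ℝ public

-- Strict order: the approximations eventually stay apart by a fixed
-- positive rational gap.
infix 4 _<ᵣ_
_<ᵣ_ : ℝ → ℝ → Set
x <ᵣ y = ∃[ η ] (0ℚ < η × ∃[ M ] (∀ m → M ℕ.≤ m → approx x m + η ≤ approx y m))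

fromℚ : ℚ → ℝ
fromℚ p = mkℝ (λ _ → p) λ ε 0<ε →
  0 , λ _ _ _ _ → subst (_< ε) (sym (cong ∣_∣ (ℚ.+-inverseʳ p))) 0<ε

private
  half : ∀ {ε} → 0ℚ < ε → 0ℚ < ½ * ε
  half {ε} 0<ε = subst (_< ½ * ε) (ℚ.*-zeroʳ ½) (ℚ.*-monoʳ-<-pos ½ 0<ε)

  ∣p∣-∣q∣≤∣p-q∣ : ∀ p q → ∣ p ∣ - ∣ q ∣ ≤ ∣ p - q ∣
  ∣p∣-∣q∣≤∣p-q∣ p q = begin
    ∣ p ∣ - ∣ q ∣              ≡⟨ cong (λ r → ∣ r ∣ - ∣ q ∣) (p≡ p q) ⟩
    ∣ (p - q) + q ∣ - ∣ q ∣    ≤⟨ ℚ.+-monoˡ-≤ (- ∣ q ∣) (ℚ.∣p+q∣≤∣p∣+∣q∣ (p - q) q) ⟩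
    ∣ p - q ∣ + ∣ q ∣ - ∣ q ∣  ≡⟨ cancel ∣ p - q ∣ ∣ q ∣ ⟩
    ∣ p - q ∣                  ∎
    where
    open ℚ.≤-Reasoning
    open +-*-Solver
    p≡ : ∀ x y → x ≡ (x - y) + y
    p≡ = solve 2 (λ x y → x := (x :- y) :+ y) refl
    cancel : ∀ x y → x + y - y ≡ x
    cancel = solve 2 (λ x y → x :+ y :- y := x) refl

  ∣∣p∣-∣q∣∣≤∣p-q∣ : ∀ p q → ∣ ∣ p ∣ - ∣ q ∣ ∣ ≤ ∣ p - q ∣
  ∣∣p∣-∣q∣∣≤∣p-q∣ p q with ℚ.∣p∣≡p∨∣p∣≡-p (∣ p ∣ - ∣ q ∣)
  ... | inj₁ eq = ℚ.≤-trans (ℚ.≤-reflexive eq) (∣p∣-∣q∣≤∣p-q∣ p q)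
  ... | inj₂ eq = begin
    ∣ ∣ p ∣ - ∣ q ∣ ∣  ≡⟨ eq ⟩
    - (∣ p ∣ - ∣ q ∣)  ≡⟨ flip ∣ p ∣ ∣ q ∣ ⟩
    ∣ q ∣ - ∣ p ∣      ≤⟨ ∣p∣-∣q∣≤∣p-q∣ q p ⟩
    ∣ q - p ∣          ≡⟨ ℚ.∣-p∣≡∣p∣ (q - p) ⟨
    ∣ - (q - p) ∣      ≡⟨ cong ∣_∣ (flip q p) ⟩
    ∣ p - q ∣          ∎
    where
    open ℚ.≤-Reasoning
    open +-*-Solver
    flip : ∀ x y → - (x - y) ≡ y - x
    flip = solve 2 (λ x y → :- (x :- y) := y :- x) refl

infixl 6 _-ᵣ_
_-ᵣ_ : ℝ → ℝ → ℝ
approx (x -ᵣ y) n = approx x n - approx y n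
cauchy (x -ᵣ y) ε 0<ε
  with M , ∣x∣< ← cauchy x (½ * ε) (half 0<ε)
     | N , ∣y∣< ← cauchy y (½ * ε) (half 0<ε)
  = M ℕ.⊔ N , λ m n M⊔N≤m M⊔N≤n → begin-strict
    ∣ (approx x m - approx y m) - (approx x n - approx y n) ∣
      ≡⟨ cong ∣_∣ (regroup (approx x m) (approx y m) (approx x n) (approx y n)) ⟩
    ∣ (approx x m - approx x n) - (approx y m - approx y n) ∣
      ≤⟨ ℚ.∣p-q∣≤∣p∣+∣q∣ (approx x m - approx x n) (approx y m - approx y n) ⟩
    ∣ approx x m - approx x n ∣ + ∣ approx y m - approx y n ∣
      <⟨ ℚ.+-mono-<
           (∣x∣< m n (ℕ.m⊔n≤o⇒m≤o M N M⊔N≤m) (ℕ.m⊔n≤o⇒m≤o M N M⊔N≤n))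
           (∣y∣< m n (ℕ.m⊔n≤o⇒n≤o M N M⊔N≤m) (ℕ.m⊔n≤o⇒n≤o M N M⊔N≤n)) ⟩
    ½ * ε + ½ * ε
      ≡⟨ ℚ.*-distribʳ-+ ε ½ ½ ⟨
    1ℚ * ε
      ≡⟨ ℚ.*-identityˡ ε ⟩
    ε ∎
  where
  open ℚ.≤-Reasoning
  open +-*-Solver
  regroup : ∀ a b c d → (a - b) - (c - d) ≡ (a - c) - (b - d)
  regroup = solve 4 (λ a b c d → (a :- b) :- (c :- d) := (a :- c) :- (b :- d)) refl

∣_∣ᵣ : ℝ → ℝ
approx ∣ x ∣ᵣ n = ∣ approx x n ∣
cauchy ∣ x ∣ᵣ ε 0<ε with M , ∣x∣< ← cauchy x ε 0<ε =
  M , λ m n M≤m M≤n →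
    ℚ.≤-<-trans (∣∣p∣-∣q∣∣≤∣p-q∣ (approx x m) (approx x n)) (∣x∣< m n M≤m M≤n)

infix 4 _⟶_
_⟶_ : (ℕ → ℚ) → ℝ → Set
a ⟶ L = ∀ (ε : ℚ) → 0ℚ < ε →
  ∃[ N ] (∀ n → N ℕ.≤ n → ∣ fromℚ (a n) -ᵣ L ∣ᵣ <ᵣ fromℚ ε)

count : {P : Pred ℕ 0ℓ} → Decidable P → ℕ → ℕ
count P? A = length (filter P? (upTo A))

-- The value at 0, where c N / N makes no sense, is irrelevant to the limit.
ratio : (ℕ → ℕ) → ℕ → ℚ
ratio c zero      = 0ℚ
ratio c N@(suc _) = + c N / N

HasDensity : {P : Pred ℕ 0ℓ} → Decidable P → ℝ → Set
HasDensity P? L = ratio (count P?) ⟶ L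

-- Elements of ℤ/dℤ are represented by integers.
infix 4 _≡_[mod_] _≡?_[mod_]
_≡_[mod_] : ℤ → ℤ → ℕ → Set
a ≡ b [mod d ] = + d ∣ a ℤ.- b

_≡?_[mod_] : ∀ a b d → Dec (a ≡ b [mod d ])
a ≡? b [mod d ] = + d ∣? a ℤ.- b

IsUnitMod : ℕ → ℤ → Set
IsUnitMod d a = ∃[ b ] (a ℤ.* b ≡ + 1 [mod d ])

UniformlyDistributedMod : (d : ℕ) .{{_ : NonZero d}} → (ℕ → ℕ) → Set
UniformlyDistributedMod d f =
  ∀ (c : ℤ) → HasDensity (λ n → + f n ≡? c [mod d ]) (fromℚ (+ 1 / d))

-- Largest k ≤ b with q ^ k ∣ n.
maxExponent : (q n b : ℕ) → ℕ
maxExponent q n zero    = 0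
maxExponent q n (suc b) with q ℕ.^ suc b ℕ.∣? n
... | yes _ = suc b
... | no  _ = maxExponent q n b

-- For q ≥ 2 and n > 0 the bound n on the exponent loses nothing; see
-- v-divides and v-maximal.
v : ℕ → ℕ → ℕ
v q zero      = 0
v q n@(suc _) = maxExponent q n n

w : ℕ → ℕ → ℕ
w q n = sum (map (v q) (upTo (suc n)))

u : ℕ → ℕ → ℕ
u q n = sum (map (w q) (upTo (suc n)))

private
  maxExponent-divides : ∀ q n b → q ℕ.^ maxExponent q n b ℕ.∣ n
  maxExponent-divides q n zero = ℕ.1∣ n
  maxExponent-divides q n (suc b) with q ℕ.^ suc b ℕ.∣? n
  ... | yes q^∣n = q^∣n
  ... | no  _    = maxExponent-divides q n b

  maxExponent-maximal : ∀ q n b k → k ℕ.≤ b → q ℕ.^ k ℕ.∣ n → k ℕ.≤ maxExponent q n b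
  maxExponent-maximal q n zero    k k≤b q^k∣n = k≤b
  maxExponent-maximal q n (suc b) k k≤b q^k∣n with q ℕ.^ suc b ℕ.∣? n
  ... | yes _ = k≤b
  ... | no ∤n with ℕ.m≤n⇒m<n∨m≡n k≤b
  ...   | inj₁ (s≤s k≤b′) = maxExponent-maximal q n b k k≤b′ q^k∣n
  ...   | inj₂ refl       = ⊥-elim (∤n q^k∣n)

  k<q^k : ∀ q → 2 ℕ.≤ q → ∀ k → k ℕ.< q ℕ.^ k
  k<q^k q 2≤q zero    = s≤s z≤n
  k<q^k q 2≤q (suc k) = begin-strict
    suc k              ≤⟨ ih ⟩
    q ℕ.^ k            <⟨ ℕ.m<m+n (q ℕ.^ k) (ℕ.≤-trans (s≤s z≤n) ih) ⟩
    q ℕ.^ k ℕ.+ q ℕ.^ k  ≡⟨ cong (q ℕ.^ k ℕ.+_) (ℕ.+-identityʳ (q ℕ.^ k)) ⟨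
    2 ℕ.* q ℕ.^ k      ≤⟨ ℕ.*-monoˡ-≤ (q ℕ.^ k) 2≤q ⟩
    q ℕ.* q ℕ.^ k      ∎
    where
    open ℕ.≤-Reasoning
    ih = k<q^k q 2≤q k

v-divides : ∀ q n .{{_ : NonZero n}} → q ℕ.^ v q n ℕ.∣ n
v-divides q n@(suc _) = maxExponent-divides q n n

v-maximal : ∀ q n .{{_ : NonZero n}} → 2 ℕ.≤ q → ∀ k → q ℕ.^ k ℕ.∣ n → k ℕ.≤ v q n
v-maximal q n@(suc _) 2≤q k q^k∣n =
  maxExponent-maximal q n n k
    (ℕ.<⇒≤ (ℕ.<-≤-trans (k<q^k q 2≤q k) (ℕ.∣⇒≤ q^k∣n))) q^k∣n

record Coefficients : Set where
  constructor ⟨_,_,_,_,_⟩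
  field
    θu θw θ₂ θ₁ θ₀ : ℤ

form : ℕ → Coefficients → ℕ → ℤ
form q ⟨ θu , θw , θ₂ , θ₁ , θ₀ ⟩ n =
  θu ℤ.* + u q n ℤ.+ θw ℤ.* + w q n ℤ.+ θ₂ ℤ.* + (n ℕ.* suc n ℕ./ 2)
    ℤ.+ θ₁ ℤ.* + n ℤ.+ θ₀

solution? : ∀ q d s → Decidable (λ n → form q s n ≡ + 0 [mod d ])
solution? q d s n = form q s n ≡? + 0 [mod d ]

γ : (A q d : ℕ) → Coefficients → ℕ
γ A q d s = count (solution? q d s) A

-- δ is a relation, since the limit of γ N q d s / N need not exist a priori:
-- "δ q d s L" reads "δ(q,d;s) exists and equals L".
δ : (q d : ℕ) → Coefficients → ℝ → Set
δ q d s L = ratio (λ N → γ N q d s) ⟶ L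

δ-Exists : (q d : ℕ) → Coefficients → Set
δ-Exists q d s = ∃[ L ] δ q d s L

{-# OPTIONS --safe #-}

-- Writing n = r + q m with r < q turns the form with coefficients s into the
-- form in m with coefficients A_r s, where A_r is an integral affine map whose
-- linear part is triangular with powers of q on the diagonal; so A_r permutes
-- (ℤ/d)⁵.  Hence δ(s) is the average of the δ(A_r s), and
--   Σ_s Σ_r (δ(s) − δ(A_r s))² = 2 Σ_s δ(s) Σ_r (δ(s) − δ(A_r s)) = 0,
-- that is, δ(A_r s) = δ(s).  Let D be the map n ↦ n + 1 on coefficients with the
-- jumps of w_q ignored.  Then A_1 = A_0 D, so δ is invariant under D, while
-- D A_0 and A_0 D^q differ only by θ_w + θ_u in the constant term, because D^q
-- misses the jump at q (m + 1).  So δ is unchanged when θ_0 is replaced by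
-- θ_0 + θ_w + θ_u, and after conjugation by D also by θ_0 + θ_w + 2 θ_u, hence
-- by θ_0 + θ_u.  If θ_u is a unit, all d residues of θ_0 have the same density.
--
-- Limits are replaced throughout by null sequences of rational differences.

module Submission where

open import Defs
open import Algebra.Bundles using (CommutativeRing)
import Algebra.Properties.Semiring.Sum as Sum
open import Data.Bool.Base using (true; false; if_then_else_)
open import Data.Fin.Base as Fin using (Fin; toℕ; fromℕ<)
open import Data.Fin.Permutation using (permutation)
import Data.Fin.Properties as Fin
open import Data.Integer.Base as ℤ using (ℤ; +_; 0ℤ; 1ℤ)
import Data.Integer.DivMod as ℤ
open import Data.Integer.Divisibility.Signed as ℤ using (_∣_; divides)
import Data.Integer.Properties as ℤ
import Data.Integer.Solver as ℤ-Solver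
open import Data.List.Base using (map; upTo; _∷ʳ_; _++_; [_]; length; filter)
open import Data.List.Properties
  using (upTo-∷ʳ; map-++; filter-++; length-++; length-filter; length-upTo)
open import Data.Nat.Base as ℕ using (ℕ; zero; suc; NonZero; _≤_; z≤n; s≤s)
open import Data.Nat.Coprimality as Coprime using (Coprime)
import Data.Nat.Divisibility as ℕ
import Data.Nat.DivMod as ℕ
open import Data.Nat.GCD using (module Bézout)
open import Data.Nat.ListAction using () renaming (sum to sumℕ)
open import Data.Nat.ListAction.Properties using (sum-++)
import Data.Nat.Properties as ℕ
import Data.Nat.Solver as ℕ-Solver
open import Data.Product.Base using (_×_; _,_; ∃-syntax)
open import Data.Rational.Base as ℚ
  using (ℚ; 0ℚ; 1ℚ; ½; _+_; _*_; _-_; -_; _<_; ∣_∣; 1/_; _/_; toℚᵘ; fromℚᵘ)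
import Data.Rational.Properties as ℚ
import Data.Rational.Solver as ℚ-Solver
open import Data.Rational.Unnormalised.Base as ℚᵘ using (mkℚᵘ; *≡*)
import Data.Rational.Unnormalised.Properties as ℚᵘ
open import Data.Sum.Base using (inj₁; inj₂)
open import Data.Vec.Base using (Vec; []; _∷_)
open import Data.Vec.Relation.Binary.Pointwise.Inductive as Pointwise
  using (Pointwise; []; _∷_)
open import Function.Base using (_∘_; _$_; id)
open import Level using (0ℓ)
open import Relation.Binary.Bundles using (Setoid)
open import Relation.Binary.PropositionalEquality
  using (_≡_; _≢_; refl; sym; trans; cong; cong₂; subst; module ≡-Reasoning)
import Relation.Binary.Reasoning.Setoid as SetoidReasoning
open import Relation.Nullary using (¬_; contradiction; Dec; yes; no; does)
open import Relation.Unary using (Pred; Decidable)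

-- Base-q digits

sum-map-upTo-suc : ∀ f n → sumℕ (map f (upTo (suc n))) ≡ sumℕ (map f (upTo n)) ℕ.+ f n
sum-map-upTo-suc f n = begin
  sumℕ (map f (upTo (suc n)))              ≡⟨ cong (sumℕ ∘ map f) (upTo-∷ʳ n) ⟨
  sumℕ (map f (upTo n ∷ʳ n))               ≡⟨ cong sumℕ (map-++ f (upTo n) [ n ]) ⟩
  sumℕ (map f (upTo n) ∷ʳ f n)             ≡⟨ sum-++ (map f (upTo n)) [ f n ] ⟩
  sumℕ (map f (upTo n)) ℕ.+ (f n ℕ.+ 0)    ≡⟨ cong (sumℕ (map f (upTo n)) ℕ.+_)
                                                 (ℕ.+-identityʳ (f n)) ⟩
  sumℕ (map f (upTo n)) ℕ.+ f n            ∎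
  where open ≡-Reasoning

triangle : ℕ → ℕ
triangle n = n ℕ.* suc n ℕ./ 2

triangle-suc : ∀ n → triangle (suc n) ≡ triangle n ℕ.+ suc n
triangle-suc n = begin
  suc n ℕ.* suc (suc n) ℕ./ 2           ≡⟨ cong (ℕ._/ 2) (expand n) ⟩
  (n ℕ.* suc n ℕ.+ suc n ℕ.* 2) ℕ./ 2   ≡⟨ ℕ.+-distrib-/-∣ʳ (n ℕ.* suc n) (ℕ.n∣m*n (suc n)) ⟩
  triangle n ℕ.+ suc n ℕ.* 2 ℕ./ 2      ≡⟨ cong (triangle n ℕ.+_) (ℕ.m*n/n≡m (suc n) 2) ⟩
  triangle n ℕ.+ suc n                  ∎
  where
  open ≡-Reasoning
  open ℕ-Solver.+-*-Solver
  expand : ∀ n → suc n ℕ.* suc (suc n) ≡ n ℕ.* suc n ℕ.+ suc n ℕ.* 2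
  expand = solve 1 (λ n → (con 1 :+ n) :* (con 2 :+ n) :=
    n :* (con 1 :+ n) :+ (con 1 :+ n) :* con 2) refl

triangle-+ : ∀ m n → triangle (m ℕ.+ n) ≡ triangle m ℕ.+ triangle n ℕ.+ m ℕ.* n
triangle-+ zero    n = sym (ℕ.+-identityʳ _)
triangle-+ (suc m) n
  rewrite triangle-suc (m ℕ.+ n) | triangle-suc m | triangle-+ m n =
  regroup (triangle m) (triangle n) m n
  where
  open ℕ-Solver.+-*-Solver
  regroup : ∀ s t m n → s ℕ.+ t ℕ.+ m ℕ.* n ℕ.+ suc (m ℕ.+ n) ≡
    s ℕ.+ suc m ℕ.+ t ℕ.+ suc m ℕ.* n
  regroup = solve 4 (λ s t m n → s :+ t :+ m :* n :+ (con 1 :+ (m :+ n)) :=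
    s :+ (con 1 :+ m) :+ t :+ (con 1 :+ m) :* n) refl

module _ (q : ℕ) (2≤q : 2 ≤ q) where

  private instance
    q≢0 : NonZero q
    q≢0 = ℕ.>-nonZero (ℕ.<-≤-trans (s≤s z≤n) 2≤q)

  v-∤ : ∀ n .{{_ : NonZero n}} → ¬ q ℕ.∣ n → v q n ≡ 0
  v-∤ n q∤n with v q n | v-divides q n
  ... | zero  | _    = refl
  ... | suc k | q^∣n = contradiction (ℕ.∣-trans (ℕ.m∣m*n (q ℕ.^ k)) q^∣n) q∤n

  -- Multiplying a power of `q` that divides `m` by `q` gives the lower bound. A power with positive
  -- exponent that divides `q m` loses one factor `q`, which gives the upper bound; prime
  -- factorisation does not enter, so `q` may be composite.
  v-* : ∀ m .{{_ : NonZero m}} → v q (q ℕ.* m) ≡ suc (v q m)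
  v-* m = ℕ.≤-antisym upper lower
    where
    instance
      qm≢0 : NonZero (q ℕ.* m)
      qm≢0 = ℕ.m*n≢0 q m
    lower : suc (v q m) ≤ v q (q ℕ.* m)
    lower = v-maximal q (q ℕ.* m) 2≤q (suc (v q m)) (ℕ.*-monoʳ-∣ q (v-divides q m))
    upper : v q (q ℕ.* m) ≤ suc (v q m)
    upper with v q (q ℕ.* m) | v-divides q (q ℕ.* m)
    ... | zero  | _     = z≤n
    ... | suc k | q^∣qm = s≤s (v-maximal q m 2≤q k (ℕ.*-cancelˡ-∣ q q^∣qm))

  w-suc : ∀ n → w q (suc n) ≡ w q n ℕ.+ v q (suc n)
  w-suc n = sum-map-upTo-suc (v q) (suc n)

  u-suc : ∀ n → u q (suc n) ≡ u q n ℕ.+ w q (suc n)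
  u-suc n = sum-map-upTo-suc (w q) (suc n)

  v-digit : ∀ r m → suc r ℕ.< q → v q (suc r ℕ.+ m ℕ.* q) ≡ 0
  v-digit r m r<q = v-∤ (suc r ℕ.+ m ℕ.* q)
    (λ q∣ → ℕ.>⇒∤ r<q
      (ℕ.∣m+n∣m⇒∣n (subst (q ℕ.∣_) (ℕ.+-comm (suc r) (m ℕ.* q)) q∣) (ℕ.n∣m*n m)))

  private
    last : ℕ.pred q ℕ.< q
    last = ℕ.≤-reflexive (ℕ.suc-pred q)

    carry : ∀ m → suc m ℕ.* q ≡ suc (ℕ.pred q ℕ.+ m ℕ.* q)
    carry m = cong (ℕ._+ m ℕ.* q) (sym (ℕ.suc-pred q))

  -- Up to `r + m q` only the multiples q, 2 q, ..., m q have a nonzero valuation, and by `v-*` the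
  -- valuation of `q i` exceeds that of `i` by one.
  w-digit : ∀ r m → r ℕ.< q → w q (r ℕ.+ m ℕ.* q) ≡ m ℕ.+ w q m
  w-digit (suc r) m r<q = begin
    w q (suc r ℕ.+ m ℕ.* q)
      ≡⟨ w-suc (r ℕ.+ m ℕ.* q) ⟩
    w q (r ℕ.+ m ℕ.* q) ℕ.+ v q (suc r ℕ.+ m ℕ.* q)
      ≡⟨ cong₂ ℕ._+_ (w-digit r m (ℕ.<⇒≤ r<q)) (v-digit r m r<q) ⟩
    m ℕ.+ w q m ℕ.+ 0
      ≡⟨ ℕ.+-identityʳ _ ⟩
    m ℕ.+ w q m ∎
    where open ≡-Reasoning
  w-digit zero zero    _ = refl
  -- A new block starts at a multiple of `q`. Its predecessor has last digit `pred q` in block `m`,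
  -- so the recursion decreases `m` while the digit grows.
  w-digit zero (suc m) _ = begin
    w q (suc m ℕ.* q)
      ≡⟨ cong (w q) (carry m) ⟩
    w q (suc (ℕ.pred q ℕ.+ m ℕ.* q))
      ≡⟨ w-suc (ℕ.pred q ℕ.+ m ℕ.* q) ⟩
    w q (ℕ.pred q ℕ.+ m ℕ.* q) ℕ.+ v q (suc (ℕ.pred q ℕ.+ m ℕ.* q))
      ≡⟨ cong₂ ℕ._+_ (w-digit (ℕ.pred q) m last)
           (cong (v q) (trans (sym (carry m)) (ℕ.*-comm (suc m) q))) ⟩
    m ℕ.+ w q m ℕ.+ v q (q ℕ.* suc m)
      ≡⟨ cong (m ℕ.+ w q m ℕ.+_) (v-* (suc m)) ⟩
    m ℕ.+ w q m ℕ.+ suc (v q (suc m))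
      ≡⟨ ℕ.+-suc _ _ ⟩
    suc (m ℕ.+ w q m ℕ.+ v q (suc m))
      ≡⟨ cong suc (ℕ.+-assoc m _ _) ⟩
    suc m ℕ.+ (w q m ℕ.+ v q (suc m))
      ≡⟨ cong (suc m ℕ.+_) (w-suc m) ⟨
    suc m ℕ.+ w q (suc m) ∎
    where open ≡-Reasoning

  u-digit-suc : ∀ r m → suc r ℕ.< q →
    u q (suc r ℕ.+ m ℕ.* q) ≡ u q (r ℕ.+ m ℕ.* q) ℕ.+ (m ℕ.+ w q m)
  u-digit-suc r m r<q = trans (u-suc (r ℕ.+ m ℕ.* q))
    (cong (u q (r ℕ.+ m ℕ.* q) ℕ.+_) (w-digit (suc r) m r<q))

  -- Stated with q (m + w q m) on the left, so that no subtraction occurs.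
  u-digit : ∀ r m → r ℕ.< q →
    u q (r ℕ.+ m ℕ.* q) ℕ.+ q ℕ.* (m ℕ.+ w q m) ≡
    q ℕ.* (u q m ℕ.+ triangle m) ℕ.+ suc r ℕ.* (m ℕ.+ w q m)
  u-digit (suc r) m r<q = begin
    u q (suc r ℕ.+ m ℕ.* q) ℕ.+ q ℕ.* x
      ≡⟨ cong (ℕ._+ q ℕ.* x) (u-digit-suc r m r<q) ⟩
    u q (r ℕ.+ m ℕ.* q) ℕ.+ x ℕ.+ q ℕ.* x
      ≡⟨ swap (u q (r ℕ.+ m ℕ.* q)) x (q ℕ.* x) ⟩
    x ℕ.+ (u q (r ℕ.+ m ℕ.* q) ℕ.+ q ℕ.* x)
      ≡⟨ cong (x ℕ.+_) (u-digit r m (ℕ.<⇒≤ r<q)) ⟩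
    x ℕ.+ (q ℕ.* (u q m ℕ.+ triangle m) ℕ.+ suc r ℕ.* x)
      ≡⟨ assoc x (q ℕ.* (u q m ℕ.+ triangle m)) (suc r ℕ.* x) ⟩
    q ℕ.* (u q m ℕ.+ triangle m) ℕ.+ suc (suc r) ℕ.* x ∎
    where
    open ≡-Reasoning
    x = m ℕ.+ w q m
    open ℕ-Solver.+-*-Solver
    swap : ∀ a b c → a ℕ.+ b ℕ.+ c ≡ b ℕ.+ (a ℕ.+ c)
    swap = solve 3 (λ a b c → a :+ b :+ c := b :+ (a :+ c)) refl
    assoc : ∀ a b c → a ℕ.+ (b ℕ.+ c) ≡ b ℕ.+ (a ℕ.+ c)
    assoc = solve 3 (λ a b c → a :+ (b :+ c) := b :+ (a :+ c)) refl
  u-digit zero zero    _ = base q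
    where
    open ℕ-Solver.+-*-Solver
    base : ∀ q → q ℕ.* 0 ≡ q ℕ.* 0 ℕ.+ 0
    base = solve 1 (λ q → q :* con 0 := q :* con 0 :+ con 0) refl
  u-digit zero (suc m) _ = begin
    u q (suc m ℕ.* q) ℕ.+ q ℕ.* x′
      ≡⟨ cong (λ n → u q n ℕ.+ q ℕ.* x′) (carry m) ⟩
    u q (suc (ℕ.pred q ℕ.+ m ℕ.* q)) ℕ.+ q ℕ.* x′
      ≡⟨ cong (ℕ._+ q ℕ.* x′) (u-suc (ℕ.pred q ℕ.+ m ℕ.* q)) ⟩
    y ℕ.+ w q (suc (ℕ.pred q ℕ.+ m ℕ.* q)) ℕ.+ q ℕ.* x′
      ≡⟨ cong (λ z → y ℕ.+ z ℕ.+ q ℕ.* x′)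
           (trans (cong (w q) (sym (carry m))) (w-digit 0 (suc m) (ℕ.>-nonZero⁻¹ q))) ⟩
    y ℕ.+ x′ ℕ.+ q ℕ.* x′
      ≡⟨ cong (λ z → z ℕ.+ x′ ℕ.+ q ℕ.* x′) y≡ ⟩
    q ℕ.* (u q m ℕ.+ triangle m) ℕ.+ x′ ℕ.+ q ℕ.* x′
      ≡⟨ regroup q (u q m) (triangle m) (w q (suc m)) m ⟩
    q ℕ.* (u q m ℕ.+ w q (suc m) ℕ.+ (triangle m ℕ.+ suc m)) ℕ.+ 1 ℕ.* x′
      ≡⟨ cong₂ (λ a b → q ℕ.* (a ℕ.+ b) ℕ.+ 1 ℕ.* x′) (u-suc m) (triangle-suc m) ⟨
    q ℕ.* (u q (suc m) ℕ.+ triangle (suc m)) ℕ.+ 1 ℕ.* x′ ∎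
    where
    open ≡-Reasoning
    x′ = suc m ℕ.+ w q (suc m)
    y = u q (ℕ.pred q ℕ.+ m ℕ.* q)
    -- At the last digit `suc (pred q)` equals `q`, so the correction `q (m + w q m)` stands on both
    -- sides and cancels.
    y≡ : y ≡ q ℕ.* (u q m ℕ.+ triangle m)
    y≡ = ℕ.+-cancelʳ-≡ (q ℕ.* (m ℕ.+ w q m)) _ _
      (trans (u-digit (ℕ.pred q) m last)
        (cong (λ k → q ℕ.* (u q m ℕ.+ triangle m) ℕ.+ k ℕ.* (m ℕ.+ w q m)) (ℕ.suc-pred q)))
    open ℕ-Solver.+-*-Solver
    regroup : ∀ q u t w m → q ℕ.* (u ℕ.+ t) ℕ.+ (suc m ℕ.+ w) ℕ.+ q ℕ.* (suc m ℕ.+ w) ≡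
      q ℕ.* (u ℕ.+ w ℕ.+ (t ℕ.+ suc m)) ℕ.+ 1 ℕ.* (suc m ℕ.+ w)
    regroup = solve 5 (λ q u t w m → q :* (u :+ t) :+ (con 1 :+ m :+ w) :+ q :* (con 1 :+ m :+ w) :=
      q :* (u :+ w :+ (t :+ (con 1 :+ m))) :+ con 1 :* (con 1 :+ m :+ w)) refl

-- Stated with q² m on the left, so that no subtraction occurs.
triangle-* : ∀ m q → triangle (m ℕ.* q) ℕ.+ q ℕ.* q ℕ.* m ≡
  q ℕ.* q ℕ.* triangle m ℕ.+ triangle q ℕ.* m
triangle-* zero    q = base q (triangle q)
  where
  open ℕ-Solver.+-*-Solver
  base : ∀ q t → q ℕ.* q ℕ.* 0 ≡ q ℕ.* q ℕ.* 0 ℕ.+ t ℕ.* 0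
  base = solve 2 (λ q t → q :* q :* con 0 := q :* q :* con 0 :+ t :* con 0) refl
triangle-* (suc m) q = begin
  triangle (q ℕ.+ m ℕ.* q) ℕ.+ q ℕ.* q ℕ.* suc m
    ≡⟨ cong (ℕ._+ q ℕ.* q ℕ.* suc m) (triangle-+ q (m ℕ.* q)) ⟩
  triangle q ℕ.+ triangle (m ℕ.* q) ℕ.+ q ℕ.* (m ℕ.* q) ℕ.+ q ℕ.* q ℕ.* suc m
    ≡⟨ regroup₁ q m (triangle q) (triangle (m ℕ.* q)) ⟩
  triangle (m ℕ.* q) ℕ.+ q ℕ.* q ℕ.* m ℕ.+ (triangle q ℕ.+ q ℕ.* q ℕ.* suc m)
    ≡⟨ cong (ℕ._+ (triangle q ℕ.+ q ℕ.* q ℕ.* suc m)) (triangle-* m q) ⟩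
  q ℕ.* q ℕ.* triangle m ℕ.+ triangle q ℕ.* m ℕ.+ (triangle q ℕ.+ q ℕ.* q ℕ.* suc m)
    ≡⟨ regroup₂ q m (triangle q) (triangle m) ⟩
  q ℕ.* q ℕ.* (triangle m ℕ.+ suc m) ℕ.+ triangle q ℕ.* suc m
    ≡⟨ cong (λ t → q ℕ.* q ℕ.* t ℕ.+ triangle q ℕ.* suc m) (triangle-suc m) ⟨
  q ℕ.* q ℕ.* triangle (suc m) ℕ.+ triangle q ℕ.* suc m ∎
  where
  open ≡-Reasoning
  open ℕ-Solver.+-*-Solver
  regroup₁ : ∀ q m s t → s ℕ.+ t ℕ.+ q ℕ.* (m ℕ.* q) ℕ.+ q ℕ.* q ℕ.* suc m ≡
    t ℕ.+ q ℕ.* q ℕ.* m ℕ.+ (s ℕ.+ q ℕ.* q ℕ.* suc m)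
  regroup₁ = solve 4 (λ q m s t → s :+ t :+ q :* (m :* q) :+ q :* q :* (con 1 :+ m) :=
    t :+ q :* q :* m :+ (s :+ q :* q :* (con 1 :+ m))) refl
  regroup₂ : ∀ q m s t → q ℕ.* q ℕ.* t ℕ.+ s ℕ.* m ℕ.+ (s ℕ.+ q ℕ.* q ℕ.* suc m) ≡
    q ℕ.* q ℕ.* (t ℕ.+ suc m) ℕ.+ s ℕ.* suc m
  regroup₂ = solve 4 (λ q m s t → q :* q :* t :+ s :* m :+ (s :+ q :* q :* (con 1 :+ m)) :=
    q :* q :* (t :+ (con 1 :+ m)) :+ s :* (con 1 :+ m)) refl

-- Action of a base-q digit on the coefficients

shear : ∀ {k} → ℤ → (Vec ℤ k → ℤ) → (Vec ℤ k → Vec ℤ k) → Vec ℤ (suc k) → Vec ℤ (suc k)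
shear a c T (x ∷ xs) = a ℤ.* x ℤ.+ c xs ∷ T xs

-- The constant term comes first because `digit` translates each entry by an expression in later
-- entries only. Hence `digit` is a composite of shears, and its invertibility modulo `d` can be
-- read off the diagonal multipliers.
coefficients : Vec ℤ 5 → Coefficients
coefficients (θ₀ ∷ θ₁ ∷ θ₂ ∷ θw ∷ θu ∷ []) = ⟨ θu , θw , θ₂ , θ₁ , θ₀ ⟩

-- The coefficients of m ↦ form q s (r + m q), valid when r < q.
digit : ℕ → ℕ → Vec ℤ 5 → Vec ℤ 5
digit q r =
  shear 1ℤ (λ { (θ₁ ∷ θ₂ ∷ _) → + triangle r ℤ.* θ₂ ℤ.+ + r ℤ.* θ₁ }) $
  shear (+ q) (λ { (θ₂ ∷ θw ∷ θu ∷ []) →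
    θw ℤ.+ e ℤ.* θu ℤ.+ (+ triangle q ℤ.- + q ℤ.* + q ℤ.+ + q ℤ.* + r) ℤ.* θ₂ }) $
  shear (+ q ℤ.* + q) (λ { (θw ∷ θu ∷ []) → + q ℤ.* θu }) $
  shear 1ℤ (λ { (θu ∷ []) → e ℤ.* θu }) $
  shear (+ q) (λ _ → 0ℤ) id
  where
  e = 1ℤ ℤ.+ + r ℤ.- + q

-- Substitute the digit formulas for `u`, `w`, `triangle` and the argument, and collect the
-- coefficients of `u q m`, `w q m`, `triangle m`, `m` and 1. In ℤ the corrections can be moved to
-- the right, so `m + w q m` enters `u` with the factor `1 + r - q`, the `e` of `digit`.
form-digit : ∀ q → 2 ≤ q → ∀ r m → r ℕ.< q → ∀ s →
  form q (coefficients s) (r ℕ.+ m ℕ.* q) ≡ form q (coefficients (digit q r s)) m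
form-digit q 2≤q r m r<q (θ₀ ∷ θ₁ ∷ θ₂ ∷ θw ∷ θu ∷ []) = begin
  value (+ u q n) (+ w q n) (+ triangle n) (+ n)
    ≡⟨ value-cong u≡ w≡ t≡ n≡ ⟩
  value (Q ℤ.* (U ℤ.+ T) ℤ.+ (1ℤ ℤ.+ R) ℤ.* (M ℤ.+ W) ℤ.- Q ℤ.* (M ℤ.+ W)) (M ℤ.+ W)
    (TR ℤ.+ (Q ℤ.* Q ℤ.* T ℤ.+ TQ ℤ.* M ℤ.- Q ℤ.* Q ℤ.* M) ℤ.+ R ℤ.* (M ℤ.* Q)) (R ℤ.+ M ℤ.* Q)
    ≡⟨ regroup θ₀ θ₁ θ₂ θw θu Q R M U W T TR TQ ⟩
  form q (coefficients (digit q r (θ₀ ∷ θ₁ ∷ θ₂ ∷ θw ∷ θu ∷ []))) m ∎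
  where
  open ≡-Reasoning
  n = r ℕ.+ m ℕ.* q
  Q = + q
  R = + r
  M = + m
  U = + u q m
  W = + w q m
  T = + triangle m
  TR = + triangle r
  TQ = + triangle q
  value : ℤ → ℤ → ℤ → ℤ → ℤ
  value u w t n = θu ℤ.* u ℤ.+ θw ℤ.* w ℤ.+ θ₂ ℤ.* t ℤ.+ θ₁ ℤ.* n ℤ.+ θ₀
  value-cong : ∀ {u w t n u′ w′ t′ n′} → u ≡ u′ → w ≡ w′ → t ≡ t′ → n ≡ n′ →
    value u w t n ≡ value u′ w′ t′ n′
  value-cong refl refl refl refl = refl
  cancel : ∀ {x y z} → x ℤ.+ y ≡ z → x ≡ z ℤ.- y
  cancel {x} {y} refl = sym (trans (ℤ.+-assoc x y (ℤ.- y))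
    (trans (cong (λ z → x ℤ.+ z) (ℤ.+-inverseʳ y)) (ℤ.+-identityʳ x)))
  n≡ : + n ≡ R ℤ.+ M ℤ.* Q
  n≡ = cong (λ z → R ℤ.+ z) (ℤ.pos-* m q)
  w≡ : + w q n ≡ M ℤ.+ W
  w≡ = cong +_ (w-digit q 2≤q r m r<q)
  u≡ : + u q n ≡ Q ℤ.* (U ℤ.+ T) ℤ.+ (1ℤ ℤ.+ R) ℤ.* (M ℤ.+ W) ℤ.- Q ℤ.* (M ℤ.+ W)
  u≡ = cancel (begin
    + u q n ℤ.+ Q ℤ.* (M ℤ.+ W)
      ≡⟨ cong (λ z → + u q n ℤ.+ z) (sym (ℤ.pos-* q (m ℕ.+ w q m))) ⟩
    + (u q n ℕ.+ q ℕ.* (m ℕ.+ w q m))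
      ≡⟨ cong +_ (u-digit q 2≤q r m r<q) ⟩
    + (q ℕ.* (u q m ℕ.+ triangle m) ℕ.+ suc r ℕ.* (m ℕ.+ w q m))
      ≡⟨ cong₂ ℤ._+_ (ℤ.pos-* q (u q m ℕ.+ triangle m)) (ℤ.pos-* (suc r) (m ℕ.+ w q m)) ⟩
    Q ℤ.* (U ℤ.+ T) ℤ.+ (1ℤ ℤ.+ R) ℤ.* (M ℤ.+ W) ∎)
  pos-sq : ∀ k → + (q ℕ.* q ℕ.* k) ≡ Q ℤ.* Q ℤ.* + k
  pos-sq k = trans (ℤ.pos-* (q ℕ.* q) k) (cong (ℤ._* + k) (ℤ.pos-* q q))
  t*≡ : + triangle (m ℕ.* q) ≡ Q ℤ.* Q ℤ.* T ℤ.+ TQ ℤ.* M ℤ.- Q ℤ.* Q ℤ.* M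
  t*≡ = cancel (begin
    + triangle (m ℕ.* q) ℤ.+ Q ℤ.* Q ℤ.* M
      ≡⟨ cong (λ z → + triangle (m ℕ.* q) ℤ.+ z) (pos-sq m) ⟨
    + (triangle (m ℕ.* q) ℕ.+ q ℕ.* q ℕ.* m)
      ≡⟨ cong +_ (triangle-* m q) ⟩
    + (q ℕ.* q ℕ.* triangle m ℕ.+ triangle q ℕ.* m)
      ≡⟨ cong₂ ℤ._+_ (pos-sq (triangle m)) (ℤ.pos-* (triangle q) m) ⟩
    Q ℤ.* Q ℤ.* T ℤ.+ TQ ℤ.* M ∎)
  t≡ : + triangle n ≡ TR ℤ.+ (Q ℤ.* Q ℤ.* T ℤ.+ TQ ℤ.* M ℤ.- Q ℤ.* Q ℤ.* M) ℤ.+ R ℤ.* (M ℤ.* Q)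
  t≡ = begin
    + triangle n
      ≡⟨ cong +_ (triangle-+ r (m ℕ.* q)) ⟩
    TR ℤ.+ + triangle (m ℕ.* q) ℤ.+ + (r ℕ.* (m ℕ.* q))
      ≡⟨ cong₂ (λ y z → TR ℤ.+ y ℤ.+ z) t*≡
           (trans (ℤ.pos-* r (m ℕ.* q)) (cong (λ z → R ℤ.* z) (ℤ.pos-* m q))) ⟩
    TR ℤ.+ (Q ℤ.* Q ℤ.* T ℤ.+ TQ ℤ.* M ℤ.- Q ℤ.* Q ℤ.* M) ℤ.+ R ℤ.* (M ℤ.* Q) ∎
  open ℤ-Solver.+-*-Solver
  regroup : ∀ θ₀ θ₁ θ₂ θw θu Q R M U W T TR TQ →
    θu ℤ.* (Q ℤ.* (U ℤ.+ T) ℤ.+ (1ℤ ℤ.+ R) ℤ.* (M ℤ.+ W) ℤ.- Q ℤ.* (M ℤ.+ W))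
      ℤ.+ θw ℤ.* (M ℤ.+ W)
      ℤ.+ θ₂ ℤ.* (TR ℤ.+ (Q ℤ.* Q ℤ.* T ℤ.+ TQ ℤ.* M ℤ.- Q ℤ.* Q ℤ.* M) ℤ.+ R ℤ.* (M ℤ.* Q))
      ℤ.+ θ₁ ℤ.* (R ℤ.+ M ℤ.* Q) ℤ.+ θ₀
    ≡ (Q ℤ.* θu ℤ.+ 0ℤ) ℤ.* U ℤ.+ (1ℤ ℤ.* θw ℤ.+ (1ℤ ℤ.+ R ℤ.- Q) ℤ.* θu) ℤ.* W
      ℤ.+ (Q ℤ.* Q ℤ.* θ₂ ℤ.+ Q ℤ.* θu) ℤ.* T
      ℤ.+ (Q ℤ.* θ₁ ℤ.+ (θw ℤ.+ (1ℤ ℤ.+ R ℤ.- Q) ℤ.* θu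
        ℤ.+ (TQ ℤ.- Q ℤ.* Q ℤ.+ Q ℤ.* R) ℤ.* θ₂)) ℤ.* M
      ℤ.+ (1ℤ ℤ.* θ₀ ℤ.+ (TR ℤ.* θ₂ ℤ.+ R ℤ.* θ₁))
  regroup = solve 13 (λ θ₀ θ₁ θ₂ θw θu Q R M U W T TR TQ →
    θu :* (Q :* (U :+ T) :+ (con 1ℤ :+ R) :* (M :+ W) :- Q :* (M :+ W)) :+ θw :* (M :+ W)
      :+ θ₂ :* (TR :+ (Q :* Q :* T :+ TQ :* M :- Q :* Q :* M) :+ R :* (M :* Q))
      :+ θ₁ :* (R :+ M :* Q) :+ θ₀
    := (Q :* θu :+ con 0ℤ) :* U :+ (con 1ℤ :* θw :+ (con 1ℤ :+ R :- Q) :* θu) :* W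
      :+ (Q :* Q :* θ₂ :+ Q :* θu) :* T
      :+ (Q :* θ₁ :+ (θw :+ (con 1ℤ :+ R :- Q) :* θu :+ (TQ :- Q :* Q :+ Q :* R) :* θ₂)) :* M
      :+ (con 1ℤ :* θ₀ :+ (TR :* θ₂ :+ R :* θ₁))) refl

module Sumℚ = Sum (CommutativeRing.semiring ℚ.+-*-commutativeRing)
open Sumℚ using (sum)

-- Residues modulo d

module Modulus (d : ℕ) .{{_ : NonZero d}} where

  -- A record, unlike _≡_[mod_], lets the two sides be inferred.
  infix 4 _≈_
  record _≈_ (a b : ℤ) : Set where
    constructor congruent
    field ≡[mod] : a ≡ b [mod d ]
  open _≈_ public

  private
    infix 4 _via_
    _via_ : ∀ {k a b} → + d ∣ k → k ≡ a ℤ.- b → a ≈ b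
    d∣k via refl = congruent d∣k

    module _ where
      open ℤ-Solver.+-*-Solver

      negate : ∀ a b → ℤ.- (a ℤ.- b) ≡ b ℤ.- a
      negate = solve 2 (λ a b → :- (a :- b) := b :- a) refl

      telescope : ∀ a b c → a ℤ.- b ℤ.+ (b ℤ.- c) ≡ a ℤ.- c
      telescope = solve 3 (λ a b c → a :- b :+ (b :- c) := a :- c) refl

      regroup-+ : ∀ a b a′ b′ → a ℤ.- b ℤ.+ (a′ ℤ.- b′) ≡ a ℤ.+ a′ ℤ.- (b ℤ.+ b′)
      regroup-+ = solve 4 (λ a b a′ b′ → a :- b :+ (a′ :- b′) := a :+ a′ :- (b :+ b′)) refl

      regroup-* : ∀ a b a′ b′ →
        (a ℤ.- b) ℤ.* a′ ℤ.+ b ℤ.* (a′ ℤ.- b′) ≡ a ℤ.* a′ ℤ.- b ℤ.* b′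
      regroup-* = solve 4 (λ a b a′ b′ →
        (a :- b) :* a′ :+ b :* (a′ :- b′) := a :* a′ :- b :* b′) refl

  ≈-refl : ∀ {a} → a ≈ a
  ≈-refl {a} = divides 0ℤ refl via sym (ℤ.+-inverseʳ a)

  ≈-sym : ∀ {a b} → a ≈ b → b ≈ a
  ≈-sym {a} {b} (congruent p) = ℤ.∣m⇒∣-m p via negate a b

  ≈-trans : ∀ {a b c} → a ≈ b → b ≈ c → a ≈ c
  ≈-trans {a} {b} {c} (congruent p) (congruent p′) = ℤ.∣m∣n⇒∣m+n p p′ via telescope a b c

  +-cong : ∀ {a b a′ b′} → a ≈ b → a′ ≈ b′ → a ℤ.+ a′ ≈ b ℤ.+ b′
  +-cong {a} {b} {a′} {b′} (congruent p) (congruent p′) =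
    ℤ.∣m∣n⇒∣m+n p p′ via regroup-+ a b a′ b′

  *-cong : ∀ {a b a′ b′} → a ≈ b → a′ ≈ b′ → a ℤ.* a′ ≈ b ℤ.* b′
  *-cong {a} {b} {a′} {b′} (congruent p) (congruent p′) =
    ℤ.∣m∣n⇒∣m+n (ℤ.∣m⇒∣m*n a′ p) (ℤ.∣n⇒∣m*n b p′) via regroup-* a b a′ b′

  ≈-setoid : Setoid 0ℓ 0ℓ
  ≈-setoid = record
    { Carrier = ℤ
    ; _≈_ = _≈_
    ; isEquivalence = record { refl = ≈-refl ; sym = ≈-sym ; trans = ≈-trans } }

  module ≈-Reasoning = SetoidReasoning ≈-setoid

  unit-1 : IsUnitMod d 1ℤ
  unit-1 = 1ℤ , ≡[mod] (≈-refl {1ℤ})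

  unit-* : ∀ {a b} → IsUnitMod d a → IsUnitMod d b → IsUnitMod d (a ℤ.* b)
  unit-* {a} {b} (a′ , aa′≡1) (b′ , bb′≡1) = a′ ℤ.* b′ , ≡[mod] (begin
    a ℤ.* b ℤ.* (a′ ℤ.* b′)    ≡⟨ regroup a b a′ b′ ⟩
    a ℤ.* a′ ℤ.* (b ℤ.* b′)    ≈⟨ *-cong (congruent {a ℤ.* a′} {1ℤ} aa′≡1)
                                   (congruent {b ℤ.* b′} {1ℤ} bb′≡1) ⟩
    1ℤ                         ∎)
    where
    open ≈-Reasoning
    open ℤ-Solver.+-*-Solver
    regroup : ∀ a b a′ b′ → a ℤ.* b ℤ.* (a′ ℤ.* b′) ≡ a ℤ.* a′ ℤ.* (b ℤ.* b′)
    regroup = solve 4 (λ a b a′ b′ → a :* b :* (a′ :* b′) := a :* a′ :* (b :* b′)) refl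

  -- Bézout's identity supplies the inverse. Over ℕ it has two forms, according to which multiple is
  -- the larger; in the second form the inverse is `- x`.
  coprime⇒unit : ∀ {q} → Coprime q d → IsUnitMod d (+ q)
  coprime⇒unit {q} q⊥d with Coprime.coprime-Bézout q⊥d
  ... | Bézout.+- x y eq = + x , divides (+ y) (begin
        + q ℤ.* + x ℤ.- 1ℤ                ≡⟨ cong (ℤ._- 1ℤ)
                                               (trans (ℤ.*-comm (+ q) (+ x)) (sym (ℤ.pos-* x q))) ⟩
        + (x ℕ.* q) ℤ.- 1ℤ                ≡⟨ cong (λ n → + n ℤ.- 1ℤ) eq ⟨
        1ℤ ℤ.+ + (y ℕ.* d) ℤ.- 1ℤ         ≡⟨ cancel (+ (y ℕ.* d)) ⟩
        + (y ℕ.* d)                       ≡⟨ ℤ.pos-* y d ⟩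
        + y ℤ.* + d                       ∎)
    where
    open ≡-Reasoning
    open ℤ-Solver.+-*-Solver
    cancel : ∀ a → 1ℤ ℤ.+ a ℤ.- 1ℤ ≡ a
    cancel = solve 1 (λ a → con 1ℤ :+ a :- con 1ℤ := a) refl
  ... | Bézout.-+ x y eq = ℤ.- + x , divides (ℤ.- + y) (begin
        + q ℤ.* (ℤ.- + x) ℤ.- 1ℤ          ≡⟨ negate-+1 (+ q) (+ x) ⟩
        ℤ.- (1ℤ ℤ.+ + x ℤ.* + q)          ≡⟨ cong (λ z → ℤ.- (1ℤ ℤ.+ z)) (ℤ.pos-* x q) ⟨
        ℤ.- (+ suc (x ℕ.* q))             ≡⟨ cong (λ n → ℤ.- + n) eq ⟩
        ℤ.- + (y ℕ.* d)                   ≡⟨ cong ℤ.-_ (ℤ.pos-* y d) ⟩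
        ℤ.- (+ y ℤ.* + d)                 ≡⟨ ℤ.neg-distribˡ-* (+ y) (+ d) ⟩
        ℤ.- + y ℤ.* + d                   ∎)
    where
    open ≡-Reasoning
    open ℤ-Solver.+-*-Solver
    negate-+1 : ∀ q x → q ℤ.* (ℤ.- x) ℤ.- 1ℤ ≡ ℤ.- (1ℤ ℤ.+ x ℤ.* q)
    negate-+1 = solve 2 (λ q x → q :* (:- x) :- con 1ℤ := :- (con 1ℤ :+ x :* q)) refl


  -- Representatives of residue classes and sums over them

  residue : ℤ → Fin d
  residue a = fromℕ< (ℤ.n%ℕd<d a d)

  residue-≈ : ∀ a → + toℕ (residue a) ≈ a
  residue-≈ a = ≈-sym (divides (a ℤ./ℕ d) refl via (begin
    (a ℤ./ℕ d) ℤ.* + d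
      ≡⟨ cancel (+ (a ℤ.%ℕ d)) _ ⟨
    + (a ℤ.%ℕ d) ℤ.+ (a ℤ./ℕ d) ℤ.* + d ℤ.- + (a ℤ.%ℕ d)
      ≡⟨ cong₂ (λ x n → x ℤ.- + n) (ℤ.a≡a%ℕn+[a/ℕn]*n a d) (Fin.toℕ-fromℕ< (ℤ.n%ℕd<d a d)) ⟨
    a ℤ.- + toℕ (residue a) ∎))
    where
    open ≡-Reasoning
    open ℤ-Solver.+-*-Solver
    cancel : ∀ x y → x ℤ.+ y ℤ.- x ≡ y
    cancel = solve 2 (λ x y → x :+ y :- x := y) refl

  -- Two representatives differ by less than `d` in absolute value, and 0 is the only multiple of
  -- `d` in that range.
  toℕ-≈-injective : ∀ {i j : Fin d} → + toℕ i ≈ + toℕ j → i ≡ j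
  toℕ-≈-injective {i} {j} (congruent p) =
    Fin.toℕ-injective (ℤ.+-injective (ℤ.i-j≡0⇒i≡j (+ toℕ i) (+ toℕ j) (ℤ.∣i∣≡0⇒i≡0 ∣i-j∣≡0)))
    where
    ∣i-j∣<d : ℤ.∣ + toℕ i ℤ.- + toℕ j ∣ ℕ.< d
    ∣i-j∣<d = ℕ.≤-<-trans
      (ℕ.≤-trans (ℕ.≤-reflexive (cong ℤ.∣_∣ (ℤ.m-n≡m⊖n (toℕ i) (toℕ j))))
        (ℤ.∣m⊝n∣≤m⊔n (toℕ i) (toℕ j)))
      (ℕ.⊔-lub (Fin.toℕ<n i) (Fin.toℕ<n j))
    ∣i-j∣≡0 : ℤ.∣ + toℕ i ℤ.- + toℕ j ∣ ≡ 0
    ∣i-j∣≡0 with ℤ.∣ + toℕ i ℤ.- + toℕ j ∣ | ∣i-j∣<d | ℤ.∣⇒∣ᵤ p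
    ... | zero  | _   | _ = refl
    ... | suc k | k<d | d∣k = contradiction d∣k (ℕ.>⇒∤ k<d)

  Σmod : (ℤ → ℚ) → ℚ
  Σmod g = sum {d} (λ i → g (+ toℕ i))

  -- Functions on ℤ/d are encoded as periodic functions on ℤ, in place of functions on a quotient.
  Periodic : (ℤ → ℚ) → Set
  Periodic g = ∀ {a b} → a ≈ b → g a ≡ g b

  -- If `b` inverts `a`, then y ↦ b (y - c) inverts x ↦ a x + c on ℤ/d, so the substitution merely
  -- permutes the summands.
  Σmod-affine : ∀ {a} → IsUnitMod d a → ∀ c g → Periodic g →
    Σmod (λ x → g (a ℤ.* x ℤ.+ c)) ≡ Σmod g
  Σmod-affine {a} (b , ab≡1) c g g-periodic = sym (trans
    (Sumℚ.sum-permute (λ i → g (+ toℕ i)) (permutation to from to-from from-to))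
    (Sumℚ.sum-cong-≗ {d} (λ i → g-periodic (residue-≈ (a ℤ.* + toℕ i ℤ.+ c)))))
    where
    open ≈-Reasoning
    open ℤ-Solver.+-*-Solver
    to from : Fin d → Fin d
    to i = residue (a ℤ.* + toℕ i ℤ.+ c)
    from j = residue (b ℤ.* (+ toℕ j ℤ.- c))
    ab≈1 : a ℤ.* b ≈ 1ℤ
    ab≈1 = congruent ab≡1
    regroup₁ : ∀ a b c j → a ℤ.* (b ℤ.* (j ℤ.- c)) ℤ.+ c ≡ a ℤ.* b ℤ.* (j ℤ.- c) ℤ.+ c
    regroup₁ = solve 4 (λ a b c j → a :* (b :* (j :- c)) :+ c := a :* b :* (j :- c) :+ c) refl
    cancel : ∀ c j → 1ℤ ℤ.* (j ℤ.- c) ℤ.+ c ≡ j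
    cancel = solve 2 (λ c j → con 1ℤ :* (j :- c) :+ c := j) refl
    regroup₂ : ∀ a b c i → b ℤ.* (a ℤ.* i ℤ.+ c ℤ.- c) ≡ a ℤ.* b ℤ.* i
    regroup₂ = solve 4 (λ a b c i → b :* (a :* i :+ c :- c) := a :* b :* i) refl
    to-from : ∀ j → to (from j) ≡ j
    to-from j = toℕ-≈-injective (begin
      + toℕ (to (from j))                     ≈⟨ residue-≈ _ ⟩
      a ℤ.* + toℕ (from j) ℤ.+ c              ≈⟨ +-cong (*-cong (≈-refl {a}) (residue-≈ _)) ≈-refl ⟩
      a ℤ.* (b ℤ.* (+ toℕ j ℤ.- c)) ℤ.+ c     ≡⟨ regroup₁ a b c (+ toℕ j) ⟩
      a ℤ.* b ℤ.* (+ toℕ j ℤ.- c) ℤ.+ c       ≈⟨ +-cong (*-cong ab≈1 ≈-refl) ≈-refl ⟩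
      1ℤ ℤ.* (+ toℕ j ℤ.- c) ℤ.+ c            ≡⟨ cancel c (+ toℕ j) ⟩
      + toℕ j                                 ∎)
    from-to : ∀ i → from (to i) ≡ i
    from-to i = toℕ-≈-injective (begin
      + toℕ (from (to i))                     ≈⟨ residue-≈ _ ⟩
      b ℤ.* (+ toℕ (to i) ℤ.- c)              ≈⟨ *-cong (≈-refl {b})
                                                   (+-cong (residue-≈ (a ℤ.* + toℕ i ℤ.+ c)) ≈-refl) ⟩
      b ℤ.* (a ℤ.* + toℕ i ℤ.+ c ℤ.- c)       ≡⟨ regroup₂ a b c (+ toℕ i) ⟩
      a ℤ.* b ℤ.* + toℕ i                     ≈⟨ *-cong ab≈1 ≈-refl ⟩
      1ℤ ℤ.* + toℕ i                          ≡⟨ ℤ.*-identityˡ (+ toℕ i) ⟩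
      + toℕ i                                 ∎)

-- Finite sums and squares of rationals

sum-− : ∀ {n} (f g : Fin n → ℚ) → sum (λ i → f i - g i) ≡ sum f - sum g
sum-− {zero}  f g = refl
sum-− {suc n} f g = trans
  (cong (λ x → f Fin.zero - g Fin.zero + x) (sum-− (f ∘ Fin.suc) (g ∘ Fin.suc)))
  (regroup (f Fin.zero) (g Fin.zero) (sum (f ∘ Fin.suc)) (sum (g ∘ Fin.suc)))
  where
  open ℚ-Solver.+-*-Solver
  regroup : ∀ a b c e → a - b + (c - e) ≡ a + c - (b + e)
  regroup = solve 4 (λ a b c e → a :- b :+ (c :- e) := a :+ c :- (b :+ e)) refl

sum-nonNegative : ∀ {n} (f : Fin n → ℚ) → (∀ i → 0ℚ ℚ.≤ f i) → 0ℚ ℚ.≤ sum f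
sum-nonNegative {zero}  f 0≤f = ℚ.≤-refl
sum-nonNegative {suc n} f 0≤f =
  ℚ.+-mono-≤ (0≤f Fin.zero) (sum-nonNegative (f ∘ Fin.suc) (0≤f ∘ Fin.suc))

p≤p+q : ∀ p {q} → 0ℚ ℚ.≤ q → p ℚ.≤ p + q
p≤p+q p {q} 0≤q = subst (ℚ._≤ p + q) (ℚ.+-identityʳ p) (ℚ.+-monoʳ-≤ p 0≤q)

q≤p+q : ∀ {p} q → 0ℚ ℚ.≤ p → q ℚ.≤ p + q
q≤p+q {p} q 0≤p = subst (ℚ._≤ p + q) (ℚ.+-identityˡ q) (ℚ.+-monoˡ-≤ q 0≤p)

term≤sum : ∀ {n} (f : Fin n → ℚ) → (∀ i → 0ℚ ℚ.≤ f i) → ∀ i → f i ℚ.≤ sum f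
term≤sum f 0≤f Fin.zero    = p≤p+q (f Fin.zero) (sum-nonNegative (f ∘ Fin.suc) (0≤f ∘ Fin.suc))
term≤sum f 0≤f (Fin.suc i) = ℚ.≤-trans (term≤sum (f ∘ Fin.suc) (0≤f ∘ Fin.suc) i)
  (q≤p+q (sum (f ∘ Fin.suc)) (0≤f Fin.zero))

0≤p*p : ∀ p → 0ℚ ℚ.≤ p * p
0≤p*p p = subst (0ℚ ℚ.≤_) (trans (ℚ.∣p*q∣≡∣p∣*∣q∣ p p) ∣p∣*∣p∣≡p*p) (ℚ.0≤∣p∣ (p * p))
  where
  open ℚ-Solver.+-*-Solver
  square : ∀ p → (- p) * (- p) ≡ p * p
  square = solve 1 (λ p → (:- p) :* (:- p) := p :* p) refl
  ∣p∣*∣p∣≡p*p : ∣ p ∣ * ∣ p ∣ ≡ p * p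
  ∣p∣*∣p∣≡p*p with ℚ.∣p∣≡p∨∣p∣≡-p p
  ... | inj₁ eq = cong₂ _*_ eq eq
  ... | inj₂ eq = trans (cong₂ _*_ eq eq) (square p)

-- Null sequences and limits

Null : (ℕ → ℚ) → Set
Null a = ∀ ε → 0ℚ < ε → ∃[ M ] (∀ n → M ≤ n → ∣ a n ∣ < ε)

null-dominated : ∀ {a b} K → (∀ n → K ≤ n → ∣ b n ∣ ℚ.≤ ∣ a n ∣) → Null a → Null b
null-dominated K b≤a null-a ε 0<ε with M , small ← null-a ε 0<ε =
  K ℕ.⊔ M , λ n K⊔M≤n → ℚ.≤-<-trans
    (b≤a n (ℕ.m⊔n≤o⇒m≤o K M K⊔M≤n)) (small n (ℕ.m⊔n≤o⇒n≤o K M K⊔M≤n))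

null-cong : ∀ {a b} → (∀ n → a n ≡ b n) → Null a → Null b
null-cong a≡b = null-dominated 0 (λ n _ → ℚ.≤-reflexive (cong ∣_∣ (sym (a≡b n))))

null-zero : Null (λ _ → 0ℚ)
null-zero ε 0<ε = 0 , λ _ _ → 0<ε

½*-pos : ∀ {ε} → 0ℚ < ε → 0ℚ < ½ * ε
½*-pos {ε} 0<ε = subst (_< ½ * ε) (ℚ.*-zeroʳ ½) (ℚ.*-monoʳ-<-pos ½ 0<ε)

½*+½* : ∀ ε → ½ * ε + ½ * ε ≡ ε
½*+½* ε = trans (sym (ℚ.*-distribʳ-+ ε ½ ½)) (ℚ.*-identityˡ ε)

null-+ : ∀ {a b} → Null a → Null b → Null (λ n → a n + b n)
null-+ {a} {b} null-a null-b ε 0<ε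
  with M , small-a ← null-a (½ * ε) (½*-pos 0<ε)
     | N , small-b ← null-b (½ * ε) (½*-pos 0<ε) =
  M ℕ.⊔ N , λ n M⊔N≤n → begin-strict
    ∣ a n + b n ∣        ≤⟨ ℚ.∣p+q∣≤∣p∣+∣q∣ (a n) (b n) ⟩
    ∣ a n ∣ + ∣ b n ∣    <⟨ ℚ.+-mono-< (small-a n (ℕ.m⊔n≤o⇒m≤o M N M⊔N≤n))
                              (small-b n (ℕ.m⊔n≤o⇒n≤o M N M⊔N≤n)) ⟩
    ½ * ε + ½ * ε        ≡⟨ ½*+½* ε ⟩
    ε                    ∎
  where open ℚ.≤-Reasoning

null-neg : ∀ {a} → Null a → Null (λ n → - a n)
null-neg {a} = null-dominated 0 (λ n _ → ℚ.≤-reflexive (ℚ.∣-p∣≡∣p∣ (a n)))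

null-*ˡ : ∀ {a} c → Null a → Null (λ n → c * a n)
null-*ˡ {a} c null-a ε 0<ε =
  let M , small = null-a (1/ k * ε) 
        (subst (_< 1/ k * ε) (ℚ.*-zeroʳ (1/ k)) (ℚ.*-monoʳ-<-pos (1/ k) 0<ε))
  in M , λ n M≤n → begin-strict
    ∣ c * a n ∣        ≡⟨ ℚ.∣p*q∣≡∣p∣*∣q∣ c (a n) ⟩
    ∣ c ∣ * ∣ a n ∣    ≤⟨ ℚ.*-monoʳ-≤-nonNeg ∣ a n ∣ {{ℚ.∣-∣-nonNeg (a n)}}
                              (p≤p+q ∣ c ∣ (ℚ.nonNegative⁻¹ 1ℚ)) ⟩
    k * ∣ a n ∣        <⟨ ℚ.*-monoʳ-<-pos k (small n M≤n) ⟩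
    k * (1/ k * ε)     ≡⟨ ℚ.*-assoc k (1/ k) ε ⟨
    k * 1/ k * ε       ≡⟨ cong (_* ε) (ℚ.*-inverseʳ k) ⟩
    1ℚ * ε             ≡⟨ ℚ.*-identityˡ ε ⟩
    ε                  ∎
  where
  open ℚ.≤-Reasoning
  -- Adding 1 keeps `k` positive even for `c = 0`, so that ε may be divided by it.
  k = ∣ c ∣ + 1ℚ
  instance
    k-pos : ℚ.Positive k
    k-pos = ℚ.nonNeg+pos⇒pos ∣ c ∣ {{ℚ.∣-∣-nonNeg c}} 1ℚ
    k≢0 : ℚ.NonZero k
    k≢0 = ℚ.pos⇒nonZero k
    1/k-pos : ℚ.Positive (1/ k)
    1/k-pos = ℚ.1/pos⇒pos k

-- Use the hypothesis at ε²: if ε ≤ ∣a n∣, then ε² ≤ (a n)², a contradiction.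
null-√ : ∀ {a} → Null (λ n → a n * a n) → Null a
null-√ {a} null-a² ε 0<ε =
  let M , small = null-a² (ε * ε) (subst (_< ε * ε) (ℚ.*-zeroʳ ε) (ℚ.*-monoʳ-<-pos ε 0<ε))
  in M , λ n M≤n → ℚ.≰⇒> (λ ε≤∣a∣ → ℚ.<-irrefl refl (begin-strict
    ε * ε              ≤⟨ ℚ.*-monoˡ-≤-nonNeg ε {{ℚ.pos⇒nonNeg ε}} ε≤∣a∣ ⟩
    ε * ∣ a n ∣        ≤⟨ ℚ.*-monoʳ-≤-nonNeg ∣ a n ∣ {{ℚ.∣-∣-nonNeg (a n)}} ε≤∣a∣ ⟩
    ∣ a n ∣ * ∣ a n ∣  ≡⟨ ℚ.∣p*q∣≡∣p∣*∣q∣ (a n) (a n) ⟨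
    ∣ a n * a n ∣      <⟨ small n M≤n ⟩
    ε * ε              ∎))
  where
  open ℚ.≤-Reasoning
  instance
    ε-pos : ℚ.Positive ε
    ε-pos = ℚ.positive 0<ε

null-sum : ∀ {k} {a : Fin k → ℕ → ℚ} → (∀ i → Null (a i)) → Null (λ n → sum (λ i → a i n))
null-sum {zero}  null-a = null-zero
null-sum {suc k} null-a = null-+ (null-a Fin.zero) (null-sum (null-a ∘ Fin.suc))

-- This removes the real limit: from here on, existence of a density is used only as a statement
-- about rational differences.
⟶⇒Cauchy : ∀ {a L} → a ⟶ L → IsCauchy a
⟶⇒Cauchy {a} {L} a⟶L ε 0<ε with N , close ← a⟶L (½ * ε) (½*-pos 0<ε) =
  N , λ m n N≤m N≤n →
    let η , 0<η , M , bound = close m N≤m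
        θ , 0<θ , K , bound′ = close n N≤n
        -- The stage from which `L` is close depends on the index of `a`; an approximation late
        -- enough for both `m` and `n` serves as the common reference point.
        l = approx L (M ℕ.⊔ K)
        near : ∣ a m - l ∣ < ½ * ε
        near = ℚ.<-≤-trans (p<p+q ∣ a m - l ∣ 0<η) (bound (M ℕ.⊔ K) (ℕ.m≤m⊔n M K))
        near′ : ∣ a n - l ∣ < ½ * ε
        near′ = ℚ.<-≤-trans (p<p+q ∣ a n - l ∣ 0<θ) (bound′ (M ℕ.⊔ K) (ℕ.m≤n⊔m M K))
    in begin-strict
      ∣ a m - a n ∣                  ≡⟨ cong ∣_∣ (regroup (a m) (a n) l) ⟩
      ∣ (a m - l) - (a n - l) ∣      ≤⟨ ℚ.∣p-q∣≤∣p∣+∣q∣ (a m - l) (a n - l) ⟩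
      ∣ a m - l ∣ + ∣ a n - l ∣      <⟨ ℚ.+-mono-< near near′ ⟩
      ½ * ε + ½ * ε                  ≡⟨ ½*+½* ε ⟩
      ε                              ∎
  where
  open ℚ.≤-Reasoning
  open ℚ-Solver.+-*-Solver
  p<p+q : ∀ p {q} → 0ℚ < q → p < p + q
  p<p+q p {q} 0<q = subst (_< p + q) (ℚ.+-identityʳ p) (ℚ.+-monoʳ-< p 0<q)
  regroup : ∀ a b c → a - b ≡ (a - c) - (b - c)
  regroup = solve 3 (λ a b c → a :- b := (a :- c) :- (b :- c)) refl

⟶-cong : ∀ {a b L} → (∀ n → a n ≡ b n) → a ⟶ L → b ⟶ L
⟶-cong {L = L} a≡b a⟶L ε 0<ε with N , close ← a⟶L ε 0<ε =
  N , λ n N≤n → subst (λ x → ∣ fromℚ x -ᵣ L ∣ᵣ <ᵣ fromℚ ε) (a≡b n) (close n N≤n)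

null⇒⟶ : ∀ {a} p → Null (λ n → a n - p) → a ⟶ fromℚ p
null⇒⟶ {a} p null ε 0<ε with M , small ← null (½ * ε) (½*-pos 0<ε) =
  -- Half of ε bounds the difference; the other half is the gap that `_<ᵣ_` demands.
  M , λ n M≤n → ½ * ε , ½*-pos 0<ε , 0 , λ _ _ →
    ℚ.≤-trans (ℚ.+-monoˡ-≤ (½ * ε) (ℚ.<⇒≤ (small n M≤n))) (ℚ.≤-reflexive (½*+½* ε))

-- Sums over (ℤ/d)ᵏ

module Box (d : ℕ) .{{_ : NonZero d}} where
  open Modulus d

  infix 4 _≋_
  _≋_ : ∀ {k} → Vec ℤ k → Vec ℤ k → Set
  _≋_ = Pointwise _≈_

  ≋-refl : ∀ {k} {xs : Vec ℤ k} → xs ≋ xs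
  ≋-refl = Pointwise.refl ≈-refl

  VecPeriodic : ∀ {k} → (Vec ℤ k → ℚ) → Set
  VecPeriodic g = ∀ {xs ys} → xs ≋ ys → g xs ≡ g ys

  -- The head is summed innermost, with the tail fixed, so that the translation in a `shear` is
  -- constant in the inner sum.
  ΣΣmod : ∀ k → (Vec ℤ k → ℚ) → ℚ
  ΣΣmod zero    g = g []
  ΣΣmod (suc k) g = ΣΣmod k (λ xs → Σmod (λ x → g (x ∷ xs)))

  ΣΣmod-cong : ∀ k {g h} → (∀ xs → g xs ≡ h xs) → ΣΣmod k g ≡ ΣΣmod k h
  ΣΣmod-cong zero    g≡h = g≡h []
  ΣΣmod-cong (suc k) g≡h = ΣΣmod-cong k (λ xs → Sumℚ.sum-cong-≗ {d} (λ i → g≡h (+ toℕ i ∷ xs)))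

  ΣΣmod-+ : ∀ k g h → ΣΣmod k (λ xs → g xs + h xs) ≡ ΣΣmod k g + ΣΣmod k h
  ΣΣmod-+ zero    g h = refl
  ΣΣmod-+ (suc k) g h = trans
    (ΣΣmod-cong k (λ xs → Sumℚ.∑-distrib-+ {d} (λ i → g (+ toℕ i ∷ xs)) (λ i → h (+ toℕ i ∷ xs))))
    (ΣΣmod-+ k _ _)

  ΣΣmod-sum : ∀ k {m} (g : Fin m → Vec ℤ k → ℚ) →
    ΣΣmod k (λ xs → sum (λ r → g r xs)) ≡ sum (λ r → ΣΣmod k (g r))
  ΣΣmod-sum zero    g = refl
  ΣΣmod-sum (suc k) {m} g = trans
    (ΣΣmod-cong k (λ xs → Sumℚ.∑-comm {d} {m} (λ i r → g r (+ toℕ i ∷ xs))))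
    (ΣΣmod-sum k (λ r xs → Σmod (λ x → g r (x ∷ xs))))

  ΣΣmod-− : ∀ k g h → ΣΣmod k (λ xs → g xs - h xs) ≡ ΣΣmod k g - ΣΣmod k h
  ΣΣmod-− zero    g h = refl
  ΣΣmod-− (suc k) g h = trans
    (ΣΣmod-cong k (λ xs → sum-− {d} (λ i → g (+ toℕ i ∷ xs)) (λ i → h (+ toℕ i ∷ xs))))
    (ΣΣmod-− k _ _)

  private
    Σmod-tail-periodic : ∀ {k} {g : Vec ℤ (suc k) → ℚ} → VecPeriodic g →
      VecPeriodic (λ xs → Σmod (λ x → g (x ∷ xs)))
    Σmod-tail-periodic g-periodic xs≋ys =
      Sumℚ.sum-cong-≗ {d} (λ i → g-periodic (≈-refl ∷ xs≋ys))

  ΣΣmod-nonNegative : ∀ k {g} → (∀ xs → 0ℚ ℚ.≤ g xs) → 0ℚ ℚ.≤ ΣΣmod k g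
  ΣΣmod-nonNegative zero    0≤g = 0≤g []
  ΣΣmod-nonNegative (suc k) 0≤g =
    ΣΣmod-nonNegative k (λ xs → sum-nonNegative {d} _ (λ i → 0≤g (+ toℕ i ∷ xs)))

  -- The vector has arbitrary integer entries; periodicity moves each of them to its representative,
  -- which does occur in the sum.
  term≤ΣΣmod : ∀ k {g} → VecPeriodic g → (∀ xs → 0ℚ ℚ.≤ g xs) → ∀ xs → g xs ℚ.≤ ΣΣmod k g
  term≤ΣΣmod zero    g-periodic 0≤g []       = ℚ.≤-refl
  term≤ΣΣmod (suc k) {g} g-periodic 0≤g (x ∷ xs) = begin
    g (x ∷ xs)                      ≡⟨ g-periodic (residue-≈ x ∷ ≋-refl) ⟨
    g (+ toℕ (residue x) ∷ xs)      ≤⟨ term≤sum (λ i → g (+ toℕ i ∷ xs)) (λ i → 0≤g (+ toℕ i ∷ xs))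
                                         (residue x) ⟩
    Σmod (λ x → g (x ∷ xs))         ≤⟨ term≤ΣΣmod k (Σmod-tail-periodic g-periodic)
                                         (λ ys → sum-nonNegative {d} _ (λ i → 0≤g (+ toℕ i ∷ ys))) xs ⟩
    ΣΣmod (suc k) g                 ∎
    where open ℚ.≤-Reasoning

  null-ΣΣmod : ∀ k {a : Vec ℤ k → ℕ → ℚ} → (∀ xs → Null (a xs)) →
    Null (λ n → ΣΣmod k (λ xs → a xs n))
  null-ΣΣmod zero    null-a = null-a []
  null-ΣΣmod (suc k) null-a = null-ΣΣmod k (λ xs → null-sum {d} (λ i → null-a (+ toℕ i ∷ xs)))

  -- Satisfied by every T that permutes the vectors modulo d.
  record Invariant {k} (T : Vec ℤ k → Vec ℤ k) : Set where
    constructor invariant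
    field preserves : ∀ g → VecPeriodic g → ΣΣmod k (g ∘ T) ≡ ΣΣmod k g
  open Invariant

  -- For a fixed tail, `Σmod-affine` undoes the substitution in the head. What remains is a periodic
  -- function of `T xs`, to which the invariance of `T` applies.
  shear-invariant : ∀ {k a} c {T : Vec ℤ k → Vec ℤ k} →
    IsUnitMod d a → Invariant T → Invariant (shear a c T)
  shear-invariant {k} {a} c {T} a-unit T-inv = invariant λ g g-periodic → trans
    (ΣΣmod-cong k (λ xs → Σmod-affine {a} a-unit (c xs) (λ y → g (y ∷ T xs))
      (λ y≈z → g-periodic (y≈z ∷ ≋-refl))))
    (preserves T-inv (λ xs → Σmod (λ x → g (x ∷ xs))) (Σmod-tail-periodic g-periodic))

  -- Σᵣ (F s - F (A r s))² = Σᵣ (F (A r s)² - (F s)²) + 2 F(s) Σᵣ (F s - F (A r s)),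
  -- and the first sum on the right cancels upon summation over all s.
  energy : ∀ k {m} (A : Fin m → Vec ℤ k → Vec ℤ k) → (∀ r → Invariant (A r)) →
    ∀ F → VecPeriodic F →
    ΣΣmod k (λ s → sum (λ r → (F s - F (A r s)) * (F s - F (A r s)))) ≡
    ΣΣmod k (λ s → (1ℚ + 1ℚ) * (F s * sum (λ r → F s - F (A r s))))
  energy k {m} A A-inv F F-periodic = begin
    ΣΣmod k (λ s → sum (λ r → (F s - F (A r s)) * (F s - F (A r s))))
      ≡⟨ ΣΣmod-cong k expand ⟩
    ΣΣmod k (λ s → sum (λ r → F (A r s) * F (A r s) - F s * F s) + E s)
      ≡⟨ ΣΣmod-+ k (λ s → sum (λ r → F (A r s) * F (A r s) - F s * F s)) E ⟩
    ΣΣmod k (λ s → sum (λ r → F (A r s) * F (A r s) - F s * F s)) + ΣΣmod k E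
      ≡⟨ cong (_+ ΣΣmod k E) (ΣΣmod-sum k (λ r s → F (A r s) * F (A r s) - F s * F s)) ⟩
    sum (λ r → ΣΣmod k (λ s → F (A r s) * F (A r s) - F s * F s)) + ΣΣmod k E
      ≡⟨ cong (_+ ΣΣmod k E) (trans (Sumℚ.sum-cong-≗ {m} cancel) (Sumℚ.sum-replicate-zero m)) ⟩
    0ℚ + ΣΣmod k E
      ≡⟨ ℚ.+-identityˡ (ΣΣmod k E) ⟩
    ΣΣmod k E ∎
    where
    open ≡-Reasoning
    E : Vec ℤ k → ℚ
    E s = (1ℚ + 1ℚ) * (F s * sum (λ r → F s - F (A r s)))
    cancel : ∀ r → ΣΣmod k (λ s → F (A r s) * F (A r s) - F s * F s) ≡ 0ℚ
    cancel r = trans (ΣΣmod-− k (λ s → F (A r s) * F (A r s)) (λ s → F s * F s))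
      (trans (cong (_- ΣΣmod k (λ s → F s * F s))
        (preserves (A-inv r) (λ s → F s * F s)
          (λ s≋t → cong₂ _*_ (F-periodic s≋t) (F-periodic s≋t))))
        (ℚ.+-inverseʳ (ΣΣmod k (λ s → F s * F s))))
    open ℚ-Solver.+-*-Solver
    square : ∀ x y → (x - y) * (x - y) ≡ y * y - x * x + (1ℚ + 1ℚ) * x * (x - y)
    square = solve 2 (λ x y → (x :- y) :* (x :- y) :=
      y :* y :- x :* x :+ (con 1ℚ :+ con 1ℚ) :* x :* (x :- y)) refl
    expand : ∀ s → sum (λ r → (F s - F (A r s)) * (F s - F (A r s))) ≡
      sum (λ r → F (A r s) * F (A r s) - F s * F s) + E s
    expand s = begin
      sum (λ r → (F s - F (A r s)) * (F s - F (A r s)))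
        ≡⟨ Sumℚ.sum-cong-≗ {m} (λ r → square (F s) (F (A r s))) ⟩
      sum (λ r → F (A r s) * F (A r s) - F s * F s + (1ℚ + 1ℚ) * F s * (F s - F (A r s)))
        ≡⟨ Sumℚ.∑-distrib-+ {m} (λ r → F (A r s) * F (A r s) - F s * F s) _ ⟩
      sum (λ r → F (A r s) * F (A r s) - F s * F s) +
      sum (λ r → (1ℚ + 1ℚ) * F s * (F s - F (A r s)))
        ≡⟨ cong (λ z → sum (λ r → F (A r s) * F (A r s) - F s * F s) + z)
             (Sumℚ.*-distribˡ-sum {m} ((1ℚ + 1ℚ) * F s) (λ r → F s - F (A r s))) ⟨
      sum (λ r → F (A r s) * F (A r s) - F s * F s) +
      (1ℚ + 1ℚ) * F s * sum (λ r → F s - F (A r s))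
        ≡⟨ cong (λ z → sum (λ r → F (A r s) * F (A r s) - F s * F s) + z)
             (ℚ.*-assoc (1ℚ + 1ℚ) (F s) _) ⟩
      sum (λ r → F (A r s) * F (A r s) - F s * F s) + E s ∎

  -- Apply `energy` to `f` at each fixed `n`. Its right side is a finite sum of bounded factors
  -- times null sequences, hence null; its left side is a sum of squares that dominates each single
  -- (f s n - f (A r s) n)².
  harmonic⇒invariant : ∀ k {m} (A : Fin m → Vec ℤ k → Vec ℤ k) → (∀ r → Invariant (A r)) →
    (∀ r {s t} → s ≋ t → A r s ≋ A r t) →
    (f : Vec ℤ k → ℕ → ℚ) → (∀ n → VecPeriodic (λ s → f s n)) → (∀ s n → ∣ f s n ∣ ℚ.≤ 1ℚ) →
    (∀ s → Null (λ n → sum (λ r → f s n - f (A r s) n))) →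
    ∀ r s → Null (λ n → f s n - f (A r s) n)
  harmonic⇒invariant k {m} A A-inv A-cong f f-periodic f≤1 harmonic r s =
    null-√ (null-dominated 0 dominated (null-cong
      (λ n → sym (energy k A A-inv (λ s → f s n) (f-periodic n)))
      (null-ΣΣmod k (λ s → null-*ˡ (1ℚ + 1ℚ) (null-dominated 0 (bounded s) (harmonic s))))))
    where
    open ℚ.≤-Reasoning
    D : Fin m → Vec ℤ k → ℕ → ℚ
    D r s n = (f s n - f (A r s) n) * (f s n - f (A r s) n)
    0≤D : ∀ n s → 0ℚ ℚ.≤ sum (λ r → D r s n)
    0≤D n s = sum-nonNegative {m} (λ r → D r s n) (λ r → 0≤p*p (f s n - f (A r s) n))
    dominated : ∀ n → 0 ≤ n → ∣ D r s n ∣ ℚ.≤ ∣ ΣΣmod k (λ s → sum (λ r → D r s n)) ∣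
    dominated n _ = begin
      ∣ D r s n ∣
        ≡⟨ ℚ.0≤p⇒∣p∣≡p (0≤p*p (f s n - f (A r s) n)) ⟩
      D r s n
        ≤⟨ term≤sum {m} (λ r → D r s n) (λ r → 0≤p*p (f s n - f (A r s) n)) r ⟩
      sum (λ r → D r s n)
        ≤⟨ term≤ΣΣmod k (λ s≋t → Sumℚ.sum-cong-≗ {m} (λ r → cong (λ x → x * x)
             (cong₂ _-_ (f-periodic n s≋t) (f-periodic n (A-cong r s≋t))))) (0≤D n) s ⟩
      ΣΣmod k (λ s → sum (λ r → D r s n))
        ≡⟨ ℚ.0≤p⇒∣p∣≡p (ΣΣmod-nonNegative k (0≤D n)) ⟨
      ∣ ΣΣmod k (λ s → sum (λ r → D r s n)) ∣ ∎
    bounded : ∀ s n → 0 ≤ n →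
      ∣ f s n * sum (λ r → f s n - f (A r s) n) ∣ ℚ.≤ ∣ sum (λ r → f s n - f (A r s) n) ∣
    bounded s n _ = begin
      ∣ f s n * x ∣        ≡⟨ ℚ.∣p*q∣≡∣p∣*∣q∣ (f s n) x ⟩
      ∣ f s n ∣ * ∣ x ∣    ≤⟨ ℚ.*-monoʳ-≤-nonNeg ∣ x ∣ {{ℚ.∣-∣-nonNeg x}} (f≤1 s n) ⟩
      1ℚ * ∣ x ∣           ≡⟨ ℚ.*-identityˡ ∣ x ∣ ⟩
      ∣ x ∣                ∎
      where x = sum (λ r → f s n - f (A r s) n)

-- Counting

fraction-* : ∀ a m b n .{{_ : NonZero m}} .{{_ : NonZero n}} .{{_ : NonZero (m ℕ.* n)}} →
  (a / m) * (b / n) ≡ (a ℤ.* b) / (m ℕ.* n)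
fraction-* a (suc m) b (suc n) = ℚ.toℚᵘ-injective (begin
  toℚᵘ (fromℚᵘ (mkℚᵘ a m) * fromℚᵘ (mkℚᵘ b n))
    ≈⟨ ℚ.toℚᵘ-homo-* (fromℚᵘ (mkℚᵘ a m)) (fromℚᵘ (mkℚᵘ b n)) ⟩
  toℚᵘ (fromℚᵘ (mkℚᵘ a m)) ℚᵘ.* toℚᵘ (fromℚᵘ (mkℚᵘ b n))
    ≈⟨ ℚᵘ.*-cong (ℚ.toℚᵘ-fromℚᵘ (mkℚᵘ a m)) (ℚ.toℚᵘ-fromℚᵘ (mkℚᵘ b n)) ⟩
  mkℚᵘ a m ℚᵘ.* mkℚᵘ b n
    ≈⟨ ℚ.toℚᵘ-fromℚᵘ (mkℚᵘ a m ℚᵘ.* mkℚᵘ b n) ⟨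
  toℚᵘ ((a ℤ.* b) / (suc m ℕ.* suc n)) ∎)
  where open ℚᵘ.≃-Reasoning

fraction-≡ : ∀ a m b n .{{_ : NonZero m}} .{{_ : NonZero n}} →
  a ℤ.* + n ≡ b ℤ.* + m → a / m ≡ b / n
fraction-≡ a (suc m) b (suc n) eq = ℚ.fromℚᵘ-cong {mkℚᵘ a m} {mkℚᵘ b n} (*≡* eq)

ι : ℕ → ℚ
ι n = + n / 1

ι-suc : ∀ n → ι (suc n) ≡ ι n + 1ℚ
ι-suc n = ℚ.toℚᵘ-injective (begin
  toℚᵘ (ι (suc n))                ≈⟨ ℚ.toℚᵘ-fromℚᵘ (mkℚᵘ (+ suc n) 0) ⟩
  mkℚᵘ (+ suc n) 0                ≈⟨ *≡* (eq (+ n)) ⟩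
  mkℚᵘ (+ n) 0 ℚᵘ.+ ℚᵘ.1ℚᵘ        ≈⟨ ℚᵘ.+-cong (ℚ.toℚᵘ-fromℚᵘ (mkℚᵘ (+ n) 0))
                                       (ℚᵘ.≃-refl {ℚᵘ.1ℚᵘ}) ⟨
  toℚᵘ (ι n) ℚᵘ.+ toℚᵘ 1ℚ         ≈⟨ ℚ.toℚᵘ-homo-+ (ι n) 1ℚ ⟨
  toℚᵘ (ι n + 1ℚ)                 ∎)
  where
  open ℚᵘ.≃-Reasoning
  open ℤ-Solver.+-*-Solver
  eq : ∀ n → (1ℤ ℤ.+ n) ℤ.* 1ℤ ≡ (n ℤ.* 1ℤ ℤ.+ 1ℤ ℤ.* 1ℤ) ℤ.* 1ℤ
  eq = solve 1 (λ n → (con 1ℤ :+ n) :* con 1ℤ :=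
    (n :* con 1ℤ :+ con 1ℤ :* con 1ℤ) :* con 1ℤ) refl

0≤ι/ : ∀ m n .{{_ : NonZero n}} → 0ℚ ℚ.≤ + m / n
0≤ι/ m n = ℚ.nonNegative⁻¹ (+ m / n) {{ℚ.normalize-nonNeg m n}}

ι-mono : ∀ {m n} → m ≤ n → ι m ℚ.≤ ι n
ι-mono {m} m≤n with k , refl ← ℕ.m≤n⇒∃[o]m+o≡n m≤n = go k
  where
  open ℚ.≤-Reasoning
  go : ∀ k → ι m ℚ.≤ ι (m ℕ.+ k)
  go zero    = ℚ.≤-reflexive (cong ι (sym (ℕ.+-identityʳ m)))
  go (suc k) = begin
    ι m                    ≤⟨ go k ⟩
    ι (m ℕ.+ k)            ≤⟨ p≤p+q (ι (m ℕ.+ k)) (ℚ.nonNegative⁻¹ 1ℚ) ⟩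
    ι (m ℕ.+ k) + 1ℚ       ≡⟨ ι-suc (m ℕ.+ k) ⟨
    ι (suc (m ℕ.+ k))      ≡⟨ cong ι (ℕ.+-suc m k) ⟨
    ι (m ℕ.+ suc k)        ∎

fraction≡ι* : ∀ m n .{{_ : NonZero n}} → + m / n ≡ ι m * (+ 1 / n)
fraction≡ι* m n@(suc _) = sym (trans (fraction-* (+ m) 1 1ℤ n)
  (fraction-≡ (+ m ℤ.* 1ℤ) (1 ℕ.* n) (+ m) n
    (cong₂ ℤ._*_ (ℤ.*-identityʳ (+ m)) (cong +_ (sym (ℕ.*-identityˡ n))))))

ι-*-recip : ∀ n .{{_ : NonZero n}} → ι n * (+ 1 / n) ≡ 1ℚ
ι-*-recip n@(suc _) = trans (sym (fraction≡ι* n n)) (fraction-≡ (+ n) n 1ℤ 1 (ℤ.*-comm (+ n) 1ℤ))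

ι-*-recip-* : ∀ n q .{{_ : NonZero n}} .{{_ : NonZero q}} .{{_ : NonZero (n ℕ.* q)}} →
  ι q * (+ 1 / (n ℕ.* q)) ≡ + 1 / n
ι-*-recip-* n@(suc _) q@(suc _) = trans (sym (fraction≡ι* q (n ℕ.* q)))
  (fraction-≡ (+ q) (n ℕ.* q) 1ℤ n (trans (sym (ℤ.pos-* q n))
    (trans (cong +_ (ℕ.*-comm q n)) (sym (ℤ.*-identityˡ (+ (n ℕ.* q)))))))

sum-const : ∀ m c → sum {m} (λ _ → c) ≡ ι m * c
sum-const zero    c = sym (ℚ.*-zeroˡ c)
sum-const (suc m) c = begin
  c + sum {m} (λ _ → c)    ≡⟨ cong (λ x → c + x) (sum-const m c) ⟩
  c + ι m * c              ≡⟨ regroup (ι m) c ⟩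
  (ι m + 1ℚ) * c           ≡⟨ cong (_* c) (ι-suc m) ⟨
  ι (suc m) * c            ∎
  where
  open ≡-Reasoning
  open ℚ-Solver.+-*-Solver
  regroup : ∀ m c → c + m * c ≡ (m + 1ℚ) * c
  regroup = solve 2 (λ m c → c :+ m :* c := (m :+ con 1ℚ) :* c) refl

sum-single : ∀ {m} (h : Fin m → ℚ) i → h i ≡ 1ℚ → (∀ j → j ≢ i → h j ≡ 0ℚ) → sum h ≡ 1ℚ
sum-single {suc m} h Fin.zero    h-i≡1 h≡0 = cong₂ _+_ h-i≡1
  (trans (Sumℚ.sum-cong-≗ {m} (λ j → h≡0 (Fin.suc j) λ ())) (Sumℚ.sum-replicate-zero m))
sum-single h (Fin.suc i) h-i≡1 h≡0 = cong₂ _+_ (h≡0 Fin.zero λ ())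
  (sum-single (h ∘ Fin.suc) i h-i≡1 (λ j j≢i → h≡0 (Fin.suc j) (j≢i ∘ Fin.suc-injective)))

-- Sums over initial segments of ℕ

Σ< : ℕ → (ℕ → ℚ) → ℚ
Σ< zero    g = 0ℚ
Σ< (suc n) g = Σ< n g + g n

Σ<-cong : ∀ n {g h} → (∀ i → g i ≡ h i) → Σ< n g ≡ Σ< n h
Σ<-cong zero    g≡h = refl
Σ<-cong (suc n) g≡h = cong₂ _+_ (Σ<-cong n g≡h) (g≡h n)

Σ<-sum : ∀ n {m} (g : Fin m → ℕ → ℚ) → Σ< n (λ i → sum (λ r → g r i)) ≡ sum (λ r → Σ< n (g r))
Σ<-sum zero    {m} g = sym (Sumℚ.sum-replicate-zero m)
Σ<-sum (suc n) g = trans (cong (_+ sum (λ r → g r n)) (Σ<-sum n g))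
  (sym (Sumℚ.∑-distrib-+ (λ r → Σ< n (g r)) (λ r → g r n)))

Σ<-+ : ∀ k n g → Σ< (k ℕ.+ n) g ≡ Σ< n g + sum {k} (λ r → g (toℕ r ℕ.+ n))
Σ<-+ zero    n g = sym (ℚ.+-identityʳ (Σ< n g))
Σ<-+ (suc k) n g = begin
  Σ< (suc (k ℕ.+ n)) g
    ≡⟨ cong (λ j → Σ< j g) (ℕ.+-suc k n) ⟨
  Σ< (k ℕ.+ suc n) g
    ≡⟨ Σ<-+ k (suc n) g ⟩
  Σ< n g + g n + sum {k} (λ r → g (toℕ r ℕ.+ suc n))
    ≡⟨ cong (λ x → Σ< n g + g n + x) (Sumℚ.sum-cong-≗ {k} (λ r → cong g (ℕ.+-suc (toℕ r) n))) ⟩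
  Σ< n g + g n + sum {k} (λ r → g (suc (toℕ r ℕ.+ n)))
    ≡⟨ ℚ.+-assoc (Σ< n g) (g n) _ ⟩
  Σ< n g + sum {suc k} (λ r → g (toℕ r ℕ.+ n)) ∎
  where open ≡-Reasoning

-- The block from `n q` up to `n q + q - 1` contributes exactly one new term, with index `n`, to the
-- sum belonging to each last digit.
Σ<-* : ∀ n q g → Σ< (n ℕ.* q) g ≡ sum {q} (λ r → Σ< n (λ m → g (toℕ r ℕ.+ m ℕ.* q)))
Σ<-* zero    q g = sym (Sumℚ.sum-replicate-zero q)
Σ<-* (suc n) q g = begin
  Σ< (q ℕ.+ n ℕ.* q) g
    ≡⟨ Σ<-+ q (n ℕ.* q) g ⟩
  Σ< (n ℕ.* q) g + sum {q} (λ r → g (toℕ r ℕ.+ n ℕ.* q))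
    ≡⟨ cong (_+ sum {q} (λ r → g (toℕ r ℕ.+ n ℕ.* q))) (Σ<-* n q g) ⟩
  sum {q} (λ r → Σ< n (λ m → g (toℕ r ℕ.+ m ℕ.* q))) + sum {q} (λ r → g (toℕ r ℕ.+ n ℕ.* q))
    ≡⟨ Sumℚ.∑-distrib-+ {q} (λ r → Σ< n (λ m → g (toℕ r ℕ.+ m ℕ.* q))) _ ⟨
  sum {q} (λ r → Σ< (suc n) (λ m → g (toℕ r ℕ.+ m ℕ.* q))) ∎
  where open ≡-Reasoning

Σ<-one : ∀ n → Σ< n (λ _ → 1ℚ) ≡ ι n
Σ<-one zero    = refl
Σ<-one (suc n) = trans (cong (_+ 1ℚ) (Σ<-one n)) (sym (ι-suc n))

-- Counting by indicators

indicator : ∀ {P : Set} → Dec P → ℚ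
indicator P? = if does P? then 1ℚ else 0ℚ

indicator-cong : ∀ {P Q : Set} (P? : Dec P) (Q? : Dec Q) → (P → Q) → (Q → P) →
  indicator P? ≡ indicator Q?
indicator-cong (yes p) (yes q) f g = refl
indicator-cong (yes p) (no ¬q) f g = contradiction (f p) ¬q
indicator-cong (no ¬p) (yes q) f g = contradiction (g q) ¬p
indicator-cong (no ¬p) (no ¬q) f g = refl

indicator-yes : ∀ {P : Set} (P? : Dec P) → P → indicator P? ≡ 1ℚ
indicator-yes (yes _) p = refl
indicator-yes (no ¬p) p = contradiction p ¬p

indicator-no : ∀ {P : Set} (P? : Dec P) → ¬ P → indicator P? ≡ 0ℚ
indicator-no (yes p) ¬p = contradiction p ¬p
indicator-no (no _)  ¬p = refl

count≡Σ< : ∀ {P : Pred ℕ 0ℓ} (P? : Decidable P) n → ι (count P? n) ≡ Σ< n (λ i → indicator (P? i))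
count≡Σ< P? zero    = refl
count≡Σ< P? (suc n) = begin
  ι (length (filter P? (upTo (suc n))))
    ≡⟨ cong (ι ∘ length ∘ filter P?) (upTo-∷ʳ n) ⟨
  ι (length (filter P? (upTo n ++ [ n ])))
    ≡⟨ cong (ι ∘ length) (filter-++ P? (upTo n) [ n ]) ⟩
  ι (length (filter P? (upTo n) ++ filter P? [ n ]))
    ≡⟨ cong ι (length-++ (filter P? (upTo n))) ⟩
  ι (count P? n ℕ.+ length (filter P? [ n ]))
    ≡⟨ step ⟩
  ι (count P? n) + indicator (P? n)
    ≡⟨ cong (_+ indicator (P? n)) (count≡Σ< P? n) ⟩
  Σ< (suc n) (λ i → indicator (P? i)) ∎
  where
  open ≡-Reasoning
  step : ι (count P? n ℕ.+ length (filter P? [ n ])) ≡ ι (count P? n) + indicator (P? n)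
  -- `filter` and `indicator` both branch on `does`, so a single split evaluates both sides.
  step with does (P? n)
  ... | true  = trans (cong ι (ℕ.+-comm (count P? n) 1)) (ι-suc (count P? n))
  ... | false = trans (cong ι (ℕ.+-identityʳ (count P? n))) (sym (ℚ.+-identityʳ (ι (count P? n))))

∣ratio-count∣≤1 : ∀ {P : Pred ℕ 0ℓ} (P? : Decidable P) n → ∣ ratio (count P?) n ∣ ℚ.≤ 1ℚ
-- Here the default value 0 of `ratio` is used.
∣ratio-count∣≤1 P? zero      = ℚ.nonNegative⁻¹ 1ℚ
∣ratio-count∣≤1 P? n@(suc _) = begin
  ∣ + count P? n / n ∣          ≡⟨ ℚ.0≤p⇒∣p∣≡p (0≤ι/ (count P? n) n) ⟩
  + count P? n / n              ≡⟨ fraction≡ι* (count P? n) n ⟩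
  ι (count P? n) * (+ 1 / n)    ≤⟨ ℚ.*-monoʳ-≤-nonNeg (+ 1 / n) {{ℚ.normalize-nonNeg 1 n}}
                                     (ι-mono count≤n) ⟩
  ι n * (+ 1 / n)               ≡⟨ ι-*-recip n ⟩
  1ℚ                            ∎
  where
  open ℚ.≤-Reasoning
  count≤n : count P? n ≤ n
  count≤n = subst (count P? n ≤_) (length-upTo n) (length-filter P? (upTo n))

ratio-count : ∀ {P : Pred ℕ 0ℓ} (P? : Decidable P) n .{{_ : NonZero n}} →
  ratio (count P?) n ≡ Σ< n (λ i → indicator (P? i)) * (+ 1 / n)
ratio-count P? n@(suc _) =
  trans (fraction≡ι* (count P? n) n) (cong (_* (+ 1 / n)) (count≡Σ< P? n))

ratio-count-cong : ∀ {P Q : Pred ℕ 0ℓ} (P? : Decidable P) (Q? : Decidable Q) →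
  (∀ i → indicator (P? i) ≡ indicator (Q? i)) → ∀ n → ratio (count P?) n ≡ ratio (count Q?) n
ratio-count-cong P? Q? P≡Q zero      = refl
ratio-count-cong P? Q? P≡Q n@(suc _) = begin
  ratio (count P?) n                             ≡⟨ ratio-count P? n ⟩
  Σ< n (λ i → indicator (P? i)) * (+ 1 / n)      ≡⟨ cong (_* (+ 1 / n)) (Σ<-cong n P≡Q) ⟩
  Σ< n (λ i → indicator (Q? i)) * (+ 1 / n)      ≡⟨ ratio-count Q? n ⟨
  ratio (count Q?) n                             ∎
  where open ≡-Reasoning

-- Densities

module Density (q d : ℕ) .{{_ : NonZero d}} (2≤q : 2 ≤ q) (q⊥d : Coprime q d) where
  open Modulus d
  open Box d

  private instance
    q≢0 : NonZero q
    q≢0 = ℕ.>-nonZero (ℕ.<-≤-trans (s≤s z≤n) 2≤q)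

  hit : Vec ℤ 5 → ℕ → ℚ
  hit s n = indicator (solution? q d (coefficients s) n)

  f : Vec ℤ 5 → ℕ → ℚ
  f s n = ratio (λ N → γ N q d (coefficients s)) n

  form-cong : ∀ n {s t} → s ≋ t → form q (coefficients s) n ≈ form q (coefficients t) n
  form-cong n (p₀ ∷ p₁ ∷ p₂ ∷ pw ∷ pu ∷ []) =
    +-cong (+-cong (+-cong (+-cong (*-congʳ pu (u q n)) (*-congʳ pw (w q n)))
      (*-congʳ p₂ (n ℕ.* suc n ℕ./ 2))) (*-congʳ p₁ n)) p₀
    where
    *-congʳ : ∀ {a b} → a ≈ b → ∀ k → a ℤ.* + k ≈ b ℤ.* + k
    *-congʳ {a} {b} p k = *-cong p (≈-refl {+ k})

  indicator-0-cong : ∀ {a b} → a ≈ b → indicator (a ≡? 0ℤ [mod d ]) ≡ indicator (b ≡? 0ℤ [mod d ])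
  indicator-0-cong {a} {b} a≈b = indicator-cong (a ≡? 0ℤ [mod d ]) (b ≡? 0ℤ [mod d ])
    (λ p → ≡[mod] (≈-trans (≈-sym a≈b) (congruent {b = 0ℤ} p)))
    (λ p → ≡[mod] (≈-trans a≈b (congruent {b = 0ℤ} p)))

  f-periodic : ∀ n → VecPeriodic (λ s → f s n)
  f-periodic n {s} {t} s≋t = ratio-count-cong
    (solution? q d (coefficients s)) (solution? q d (coefficients t))
    (λ i → indicator-0-cong (form-cong i s≋t)) n

  -- Numbers below n q are split according to their last digit in base q.
  f-average : ∀ s n → ι q * f s (n ℕ.* q) ≡ sum {q} (λ r → f (digit q (toℕ r) s) n)
  -- At `n = 0` all ratios take their default value 0, so the identity has no exception.
  f-average s zero      = trans (ℚ.*-zeroʳ (ι q)) (sym (Sumℚ.sum-replicate-zero q))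
  f-average s n@(suc _) = begin
    ι q * f s (n ℕ.* q)
      ≡⟨ cong (λ x → ι q * x) (ratio-count (solution? q d (coefficients s)) (n ℕ.* q)) ⟩
    ι q * (Σ< (n ℕ.* q) (hit s) * (+ 1 / (n ℕ.* q)))
      ≡⟨ regroup (ι q) (Σ< (n ℕ.* q) (hit s)) (+ 1 / (n ℕ.* q)) ⟩
    Σ< (n ℕ.* q) (hit s) * (ι q * (+ 1 / (n ℕ.* q)))
      ≡⟨ cong₂ _*_ (Σ<-* n q (hit s)) (ι-*-recip-* n q) ⟩
    sum {q} (λ r → Σ< n (λ m → hit s (toℕ r ℕ.+ m ℕ.* q))) * (+ 1 / n)
      ≡⟨ Sumℚ.*-distribʳ-sum {q} (+ 1 / n) (λ r → Σ< n (λ m → hit s (toℕ r ℕ.+ m ℕ.* q))) ⟩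
    sum {q} (λ r → Σ< n (λ m → hit s (toℕ r ℕ.+ m ℕ.* q)) * (+ 1 / n))
      ≡⟨ Sumℚ.sum-cong-≗ {q} (λ r → trans
           (cong (_* (+ 1 / n)) (Σ<-cong n (λ m → cong (λ a → indicator (a ≡? 0ℤ [mod d ]))
             (form-digit q 2≤q (toℕ r) m (Fin.toℕ<n r) s))))
           (sym (ratio-count (solution? q d (coefficients (digit q (toℕ r) s))) n))) ⟩
    sum {q} (λ r → f (digit q (toℕ r) s) n) ∎
    where
    open ≡-Reasoning
    instance
      nq≢0 : NonZero (n ℕ.* q)
      nq≢0 = ℕ.m*n≢0 n q
    open ℚ-Solver.+-*-Solver
    regroup : ∀ a b c → a * (b * c) ≡ b * (a * c)
    regroup = solve 3 (λ a b c → a :* (b :* c) := b :* (a :* c)) refl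

  Σmod-indicator : Σmod (λ a → indicator (a ≡? 0ℤ [mod d ])) ≡ 1ℚ
  Σmod-indicator = sum-single {d} _ (residue 0ℤ) hit-0 miss
    where
    hit-0 : indicator (+ toℕ (residue 0ℤ) ≡? 0ℤ [mod d ]) ≡ 1ℚ
    hit-0 = indicator-yes (+ toℕ (residue 0ℤ) ≡? 0ℤ [mod d ]) (≡[mod] (residue-≈ 0ℤ))
    miss : ∀ i → i ≢ residue 0ℤ → indicator (+ toℕ i ≡? 0ℤ [mod d ]) ≡ 0ℚ
    miss i i≢0 = indicator-no (+ toℕ i ≡? 0ℤ [mod d ]) (λ p → i≢0
      (toℕ-≈-injective (≈-trans (congruent {b = 0ℤ} p) (≈-sym (residue-≈ 0ℤ)))))

  raise : ℤ → Vec ℤ 5 → Vec ℤ 5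
  raise x (θ₀ ∷ θs) = θ₀ ℤ.+ x ∷ θs

  -- For each n exactly one residue of θ₀ makes n a solution.
  Σmod-f≡1 : ∀ {a} → IsUnitMod d a → ∀ s n .{{_ : NonZero n}} →
    Σmod (λ x → f (raise (a ℤ.* x) s) n) ≡ 1ℚ
  Σmod-f≡1 {a} a-unit s@(θ₀ ∷ θ₁ ∷ θ₂ ∷ θw ∷ θu ∷ []) n@(suc _) = begin
    Σmod (λ x → f (raise (a ℤ.* x) s) n)
      ≡⟨ Sumℚ.sum-cong-≗ {d} (λ i → trans
           (ratio-count (solution? q d (coefficients (raise (a ℤ.* + toℕ i) s))) n)
           (cong (_* (+ 1 / n)) (Σ<-cong n (λ m → cong g (split m (a ℤ.* + toℕ i)))))) ⟩
    Σmod (λ x → Σ< n (λ m → g (a ℤ.* x ℤ.+ form q (coefficients s) m)) * (+ 1 / n))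
      ≡⟨ Sumℚ.*-distribʳ-sum {d} (+ 1 / n)
           (λ i → Σ< n (λ m → g (a ℤ.* + toℕ i ℤ.+ form q (coefficients s) m))) ⟨
    Σmod (λ x → Σ< n (λ m → g (a ℤ.* x ℤ.+ form q (coefficients s) m))) * (+ 1 / n)
      ≡⟨ cong (_* (+ 1 / n)) (Σ<-sum n {d}
           (λ i m → g (a ℤ.* + toℕ i ℤ.+ form q (coefficients s) m))) ⟨
    Σ< n (λ m → Σmod (λ x → g (a ℤ.* x ℤ.+ form q (coefficients s) m))) * (+ 1 / n)
      ≡⟨ cong (_* (+ 1 / n)) (Σ<-cong n (λ m → trans
           (Σmod-affine {a} a-unit (form q (coefficients s) m) g indicator-0-cong) Σmod-indicator)) ⟩
    Σ< n (λ _ → 1ℚ) * (+ 1 / n)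
      ≡⟨ cong (_* (+ 1 / n)) (Σ<-one n) ⟩
    ι n * (+ 1 / n)
      ≡⟨ ι-*-recip n ⟩
    1ℚ ∎
    where
    open ≡-Reasoning
    g : ℤ → ℚ
    g b = indicator (b ≡? 0ℤ [mod d ])
    split : ∀ m y → form q (coefficients (raise y s)) m ≡ y ℤ.+ form q (coefficients s) m
    split m y =
      regroup (θu ℤ.* + u q m ℤ.+ θw ℤ.* + w q m ℤ.+ θ₂ ℤ.* + triangle m ℤ.+ θ₁ ℤ.* + m) θ₀ y
      where
      open ℤ-Solver.+-*-Solver
      regroup : ∀ b c y → b ℤ.+ (c ℤ.+ y) ≡ y ℤ.+ (b ℤ.+ c)
      regroup = solve 3 (λ b c y → b :+ (c :+ y) := y :+ (b :+ c)) refl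

  -- s ~ t: if δ(s) and δ(t) exist, they are equal.
  infix 4 _~_
  record _~_ (s t : Vec ℤ 5) : Set where
    constructor asymptotic
    field null-difference : Null (λ n → f s n - f t n)
  open _~_

  private
    module _ where
      open ℚ-Solver.+-*-Solver

      negate : ∀ x y → - (x - y) ≡ y - x
      negate = solve 2 (λ x y → :- (x :- y) := y :- x) refl

      telescope : ∀ x y z → x - y + (y - z) ≡ x - z
      telescope = solve 3 (λ x y z → x :- y :+ (y :- z) := x :- z) refl

  ~-refl : ∀ {s} → s ~ s
  ~-refl {s} = asymptotic (null-cong (λ n → sym (ℚ.+-inverseʳ (f s n))) null-zero)

  ~-sym : ∀ {s t} → s ~ t → t ~ s
  ~-sym {s} {t} (asymptotic p) = asymptotic
    (null-cong (λ n → negate (f s n) (f t n)) (null-neg p))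

  ~-trans : ∀ {s t r} → s ~ t → t ~ r → s ~ r
  ~-trans {s} {t} {r} (asymptotic p) (asymptotic p′) = asymptotic
    (null-cong (λ n → telescope (f s n) (f t n) (f r n)) (null-+ p p′))

  ~-setoid : Setoid 0ℓ 0ℓ
  ~-setoid = record
    { Carrier = Vec ℤ 5
    ; _≈_ = _~_
    ; isEquivalence = record { refl = ~-refl ; sym = ~-sym ; trans = ~-trans }
    }

  -- The diagonal multipliers are 1, q, q², 1, q, all units modulo `d`; this is where coprimality of
  -- `q` and `d` enters.
  digit-invariant : ∀ r → Invariant (digit q r)
  digit-invariant r =
    shear-invariant _ unit-1 $
    shear-invariant _ q-unit $
    shear-invariant _ (unit-* {+ q} {+ q} q-unit q-unit) $
    shear-invariant _ unit-1 $
    shear-invariant _ q-unit (invariant (λ _ _ → refl))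
    where
    q-unit : IsUnitMod d (+ q)
    q-unit = coprime⇒unit q⊥d

  digit-cong : ∀ r {s t} → s ≋ t → digit q r s ≋ digit q r t
  digit-cong r (p₀ ∷ p₁ ∷ p₂ ∷ pw ∷ pu ∷ []) =
    +-cong (*-congˡ 1ℤ p₀) (+-cong (*-congˡ (+ triangle r) p₂) (*-congˡ (+ r) p₁)) ∷
    +-cong (*-congˡ (+ q) p₁) (+-cong (+-cong pw (*-congˡ e pu)) (*-congˡ h p₂)) ∷
    +-cong (*-congˡ (+ q ℤ.* + q) p₂) (*-congˡ (+ q) pu) ∷
    +-cong (*-congˡ 1ℤ pw) (*-congˡ e pu) ∷
    +-cong (*-congˡ (+ q) pu) ≈-refl ∷ []
    where
    e h : ℤ
    e = 1ℤ ℤ.+ + r ℤ.- + q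
    h = + triangle q ℤ.- + q ℤ.* + q ℤ.+ + q ℤ.* + r
    *-congˡ : ∀ c {a b} → a ≈ b → c ℤ.* a ≈ c ℤ.* b
    *-congˡ c = *-cong (≈-refl {c})

  -- The coefficients of n ↦ form q s (n + 1) when the jumps v (n + 1) of w are ignored.
  shift : Vec ℤ 5 → Vec ℤ 5
  shift (θ₀ ∷ θ₁ ∷ θ₂ ∷ θw ∷ θu ∷ []) =
    θ₀ ℤ.+ θ₂ ℤ.+ θ₁ ∷ θ₁ ℤ.+ θ₂ ∷ θ₂ ∷ θw ℤ.+ θu ∷ θu ∷ []

  -- The k-th iterate of `shift`, by `shiftBy-zero` and `shift-shiftBy`. The closed form turns the
  -- case `k = q` of `shift-digit-0` into a polynomial identity in `q` and `triangle q`.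
  shiftBy : ℕ → Vec ℤ 5 → Vec ℤ 5
  shiftBy k (θ₀ ∷ θ₁ ∷ θ₂ ∷ θw ∷ θu ∷ []) =
    θ₀ ℤ.+ + triangle k ℤ.* θ₂ ℤ.+ + k ℤ.* θ₁ ∷ θ₁ ℤ.+ + k ℤ.* θ₂ ∷ θ₂ ∷
    θw ℤ.+ + k ℤ.* θu ∷ θu ∷ []

  vec-≡ : ∀ {a b c e g a′ b′ c′ e′ : ℤ} → a ≡ a′ → b ≡ b′ → c ≡ c′ → e ≡ e′ →
    _≡_ {A = Vec ℤ 5} (a ∷ b ∷ c ∷ e ∷ g ∷ []) (a′ ∷ b′ ∷ c′ ∷ e′ ∷ g ∷ [])
  vec-≡ refl refl refl refl = refl

  shift-shiftBy : ∀ k s → shift (shiftBy k s) ≡ shiftBy (suc k) s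
  shift-shiftBy k (θ₀ ∷ θ₁ ∷ θ₂ ∷ θw ∷ θu ∷ []) = vec-≡
    (trans (eq₀ θ₀ θ₁ θ₂ (+ k) (+ triangle k))
      (cong (λ t → θ₀ ℤ.+ + t ℤ.* θ₂ ℤ.+ + suc k ℤ.* θ₁) (sym (triangle-suc k))))
    (eq₁ θ₁ θ₂ (+ k)) refl (eq₁ θw θu (+ k))
    where
    open ℤ-Solver.+-*-Solver
    eq₀ : ∀ θ₀ θ₁ θ₂ k t → θ₀ ℤ.+ t ℤ.* θ₂ ℤ.+ k ℤ.* θ₁ ℤ.+ θ₂ ℤ.+ (θ₁ ℤ.+ k ℤ.* θ₂) ≡
      θ₀ ℤ.+ (t ℤ.+ (1ℤ ℤ.+ k)) ℤ.* θ₂ ℤ.+ (1ℤ ℤ.+ k) ℤ.* θ₁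
    eq₀ = solve 5 (λ θ₀ θ₁ θ₂ k t → θ₀ :+ t :* θ₂ :+ k :* θ₁ :+ θ₂ :+ (θ₁ :+ k :* θ₂) :=
      θ₀ :+ (t :+ (con 1ℤ :+ k)) :* θ₂ :+ (con 1ℤ :+ k) :* θ₁) refl
    eq₁ : ∀ a b k → a ℤ.+ k ℤ.* b ℤ.+ b ≡ a ℤ.+ (1ℤ ℤ.+ k) ℤ.* b
    eq₁ = solve 3 (λ a b k → a :+ k :* b :+ b := a :+ (con 1ℤ :+ k) :* b) refl

  shiftBy-zero : ∀ s → shiftBy 0 s ≡ s
  shiftBy-zero (θ₀ ∷ θ₁ ∷ θ₂ ∷ θw ∷ θu ∷ []) = vec-≡ (eq₀ θ₀ θ₁ θ₂) (eq₁ θ₁ θ₂) refl (eq₁ θw θu)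
    where
    open ℤ-Solver.+-*-Solver
    eq₀ : ∀ a b c → a ℤ.+ 0ℤ ℤ.* c ℤ.+ 0ℤ ℤ.* b ≡ a
    eq₀ = solve 3 (λ a b c → a :+ con 0ℤ :* c :+ con 0ℤ :* b := a) refl
    eq₁ : ∀ a b → a ℤ.+ 0ℤ ℤ.* b ≡ a
    eq₁ = solve 2 (λ a b → a :+ con 0ℤ :* b := a) refl

  -- The step from `q m` to `q m + 1` meets no jump of `w`, since `q` does not divide `q m + 1`; so
  -- `shift` describes it exactly.
  digit-1 : ∀ s → digit q 1 s ≡ digit q 0 (shift s)
  digit-1 (θ₀ ∷ θ₁ ∷ θ₂ ∷ θw ∷ θu ∷ []) = vec-≡ (eq₀ θ₀ θ₁ θ₂)
    (eq₁ θ₁ θ₂ θw θu (+ q) (+ triangle q)) refl (eqw θw θu (+ q))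
    where
    open ℤ-Solver.+-*-Solver
    eq₀ : ∀ θ₀ θ₁ θ₂ → 1ℤ ℤ.* θ₀ ℤ.+ (1ℤ ℤ.* θ₂ ℤ.+ 1ℤ ℤ.* θ₁) ≡
      1ℤ ℤ.* (θ₀ ℤ.+ θ₂ ℤ.+ θ₁) ℤ.+ (0ℤ ℤ.* θ₂ ℤ.+ 0ℤ ℤ.* (θ₁ ℤ.+ θ₂))
    eq₀ = solve 3 (λ θ₀ θ₁ θ₂ → con 1ℤ :* θ₀ :+ (con 1ℤ :* θ₂ :+ con 1ℤ :* θ₁) :=
      con 1ℤ :* (θ₀ :+ θ₂ :+ θ₁) :+ (con 0ℤ :* θ₂ :+ con 0ℤ :* (θ₁ :+ θ₂))) refl
    eq₁ : ∀ θ₁ θ₂ θw θu q t →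
      q ℤ.* θ₁ ℤ.+ (θw ℤ.+ (1ℤ ℤ.+ 1ℤ ℤ.- q) ℤ.* θu ℤ.+ (t ℤ.- q ℤ.* q ℤ.+ q ℤ.* 1ℤ) ℤ.* θ₂) ≡
      q ℤ.* (θ₁ ℤ.+ θ₂) ℤ.+
        (θw ℤ.+ θu ℤ.+ (1ℤ ℤ.+ 0ℤ ℤ.- q) ℤ.* θu ℤ.+ (t ℤ.- q ℤ.* q ℤ.+ q ℤ.* 0ℤ) ℤ.* θ₂)
    eq₁ = solve 6 (λ θ₁ θ₂ θw θu q t →
      q :* θ₁ :+ (θw :+ (con 1ℤ :+ con 1ℤ :- q) :* θu :+ (t :- q :* q :+ q :* con 1ℤ) :* θ₂) :=
      q :* (θ₁ :+ θ₂) :+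
        (θw :+ θu :+ (con 1ℤ :+ con 0ℤ :- q) :* θu :+ (t :- q :* q :+ q :* con 0ℤ) :* θ₂)) refl
    eqw : ∀ θw θu q → 1ℤ ℤ.* θw ℤ.+ (1ℤ ℤ.+ 1ℤ ℤ.- q) ℤ.* θu ≡
      1ℤ ℤ.* (θw ℤ.+ θu) ℤ.+ (1ℤ ℤ.+ 0ℤ ℤ.- q) ℤ.* θu
    eqw = solve 3 (λ θw θu q → con 1ℤ :* θw :+ (con 1ℤ :+ con 1ℤ :- q) :* θu :=
      con 1ℤ :* (θw :+ θu) :+ (con 1ℤ :+ con 0ℤ :- q) :* θu) refl

  -- A jump of `w` by one at some `n` raises `u` at `n` by one as well; this is the resulting change
  -- of the form.
  wu : Vec ℤ 5 → ℤ
  wu (_ ∷ _ ∷ _ ∷ θw ∷ θu ∷ []) = θw ℤ.+ θu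

  leading : Vec ℤ 5 → ℤ
  leading (_ ∷ _ ∷ _ ∷ _ ∷ θu ∷ []) = θu

  -- Passing from q m to q (m + 1) directly or by q unit steps that ignore the
  -- jumps of w differs by the ignored jump v (q (m + 1)).
  shift-digit-0 : ∀ s → shift (digit q 0 s) ≡ digit q 0 (shiftBy q (raise (wu s) s))
  shift-digit-0 (θ₀ ∷ θ₁ ∷ θ₂ ∷ θw ∷ θu ∷ []) = vec-≡
    (eq₀ θ₀ θ₁ θ₂ θw θu (+ q) (+ triangle q)) (eq₁ θ₁ θ₂ θw θu (+ q) (+ triangle q)) refl
    (eqw θw θu (+ q))
    where
    open ℤ-Solver.+-*-Solver
    eq₀ : ∀ θ₀ θ₁ θ₂ θw θu q t →
      1ℤ ℤ.* θ₀ ℤ.+ (0ℤ ℤ.* θ₂ ℤ.+ 0ℤ ℤ.* θ₁) ℤ.+ (q ℤ.* q ℤ.* θ₂ ℤ.+ q ℤ.* θu) ℤ.+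
        (q ℤ.* θ₁ ℤ.+ (θw ℤ.+ (1ℤ ℤ.+ 0ℤ ℤ.- q) ℤ.* θu ℤ.+ (t ℤ.- q ℤ.* q ℤ.+ q ℤ.* 0ℤ) ℤ.* θ₂)) ≡
      1ℤ ℤ.* (θ₀ ℤ.+ (θw ℤ.+ θu) ℤ.+ t ℤ.* θ₂ ℤ.+ q ℤ.* θ₁) ℤ.+
        (0ℤ ℤ.* θ₂ ℤ.+ 0ℤ ℤ.* (θ₁ ℤ.+ q ℤ.* θ₂))
    eq₀ = solve 7 (λ θ₀ θ₁ θ₂ θw θu q t →
      con 1ℤ :* θ₀ :+ (con 0ℤ :* θ₂ :+ con 0ℤ :* θ₁) :+ (q :* q :* θ₂ :+ q :* θu) :+
        (q :* θ₁ :+ (θw :+ (con 1ℤ :+ con 0ℤ :- q) :* θu :+ (t :- q :* q :+ q :* con 0ℤ) :* θ₂)) :=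
      con 1ℤ :* (θ₀ :+ (θw :+ θu) :+ t :* θ₂ :+ q :* θ₁) :+
        (con 0ℤ :* θ₂ :+ con 0ℤ :* (θ₁ :+ q :* θ₂))) refl
    eq₁ : ∀ θ₁ θ₂ θw θu q t →
      q ℤ.* θ₁ ℤ.+ (θw ℤ.+ (1ℤ ℤ.+ 0ℤ ℤ.- q) ℤ.* θu ℤ.+ (t ℤ.- q ℤ.* q ℤ.+ q ℤ.* 0ℤ) ℤ.* θ₂) ℤ.+
        (q ℤ.* q ℤ.* θ₂ ℤ.+ q ℤ.* θu) ≡
      q ℤ.* (θ₁ ℤ.+ q ℤ.* θ₂) ℤ.+
        (θw ℤ.+ q ℤ.* θu ℤ.+ (1ℤ ℤ.+ 0ℤ ℤ.- q) ℤ.* θu ℤ.+ (t ℤ.- q ℤ.* q ℤ.+ q ℤ.* 0ℤ) ℤ.* θ₂)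
    eq₁ = solve 6 (λ θ₁ θ₂ θw θu q t →
      q :* θ₁ :+ (θw :+ (con 1ℤ :+ con 0ℤ :- q) :* θu :+ (t :- q :* q :+ q :* con 0ℤ) :* θ₂) :+
        (q :* q :* θ₂ :+ q :* θu) :=
      q :* (θ₁ :+ q :* θ₂) :+
        (θw :+ q :* θu :+ (con 1ℤ :+ con 0ℤ :- q) :* θu :+ (t :- q :* q :+ q :* con 0ℤ) :* θ₂)) refl
    eqw : ∀ θw θu q → 1ℤ ℤ.* θw ℤ.+ (1ℤ ℤ.+ 0ℤ ℤ.- q) ℤ.* θu ℤ.+ (q ℤ.* θu ℤ.+ 0ℤ) ≡
      1ℤ ℤ.* (θw ℤ.+ q ℤ.* θu) ℤ.+ (1ℤ ℤ.+ 0ℤ ℤ.- q) ℤ.* θu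
    eqw = solve 3 (λ θw θu q → con 1ℤ :* θw :+ (con 1ℤ :+ con 0ℤ :- q) :* θu :+ (q :* θu :+ con 0ℤ) :=
      con 1ℤ :* (θw :+ q :* θu) :+ (con 1ℤ :+ con 0ℤ :- q) :* θu) refl

  -- Invariance of the densities

  module _ (δ-exists : ∀ s → δ-Exists q d s) where
    open SetoidReasoning ~-setoid

    -- Existence of the density makes `f s n` and `f s (n q)` asymptotically equal. By `f-average`,
    -- `q` times the latter is the sum of `f (digit q r s) n` over all digits, so `f` is
    -- asymptotically harmonic and `harmonic⇒invariant` applies.
    ~-digit : ∀ r → r ℕ.< q → ∀ s → s ~ digit q r s
    ~-digit r r<q s = asymptotic (subst (λ k → Null (λ n → f s n - f (digit q k s) n))
      (Fin.toℕ-fromℕ< r<q)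
      (harmonic⇒invariant 5 {q} (λ r → digit q (toℕ r)) (λ r → digit-invariant (toℕ r))
        (λ r → digit-cong (toℕ r)) f f-periodic
        (λ s n → ∣ratio-count∣≤1 (solution? q d (coefficients s)) n)
        harmonic (fromℕ< r<q) s))
      where
      subsequence : ∀ s → Null (λ n → f s n - f s (n ℕ.* q))
      subsequence s ε 0<ε with L , →L ← δ-exists (coefficients s) =
        let M , close = ⟶⇒Cauchy {f s} {L} →L ε 0<ε
        in M , λ n M≤n → close n (n ℕ.* q) M≤n (ℕ.≤-trans M≤n (ℕ.m≤m*n n q))
      sum-difference : ∀ s n → ι q * (f s n - f s (n ℕ.* q)) ≡
        sum {q} (λ r → f s n - f (digit q (toℕ r) s) n)
      sum-difference s n = trans (distrib (ι q) (f s n) (f s (n ℕ.* q)))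
        (trans (cong₂ _-_ (sym (sum-const q (f s n))) (f-average s n))
          (sym (sum-− {q} (λ _ → f s n) (λ r → f (digit q (toℕ r) s) n))))
        where
        open ℚ-Solver.+-*-Solver
        distrib : ∀ a b c → a * (b - c) ≡ a * b - a * c
        distrib = solve 3 (λ a b c → a :* (b :- c) := a :* b :- a :* c) refl
      harmonic : ∀ s → Null (λ n → sum {q} (λ r → f s n - f (digit q (toℕ r) s) n))
      harmonic s = null-cong (sum-difference s) (null-*ˡ (ι q) (subsequence s))

    ~-shift : ∀ s → s ~ shift s
    ~-shift s = begin
      s                      ≈⟨ ~-digit 1 2≤q s ⟩
      digit q 1 s            ≡⟨ digit-1 s ⟩
      digit q 0 (shift s)    ≈⟨ ~-digit 0 (ℕ.<⇒≤ 2≤q) (shift s) ⟨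
      shift s                ∎

    ~-shiftBy : ∀ k s → s ~ shiftBy k s
    ~-shiftBy zero    s = begin
      s                      ≡⟨ shiftBy-zero s ⟨
      shiftBy 0 s            ∎
    ~-shiftBy (suc k) s = begin
      s                      ≈⟨ ~-shiftBy k s ⟩
      shiftBy k s            ≈⟨ ~-shift (shiftBy k s) ⟩
      shift (shiftBy k s)    ≡⟨ shift-shiftBy k s ⟩
      shiftBy (suc k) s      ∎

    -- Digits and shifts preserve densities, so in the identity `shift-digit-0` every factor except
    -- `raise` can be stripped off.
    ~-raise-wu : ∀ s → s ~ raise (wu s) s
    ~-raise-wu s = begin
      s                                          ≈⟨ ~-digit 0 (ℕ.<⇒≤ 2≤q) s ⟩
      digit q 0 s                                ≈⟨ ~-shift (digit q 0 s) ⟩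
      shift (digit q 0 s)                        ≡⟨ shift-digit-0 s ⟩
      digit q 0 (shiftBy q (raise (wu s) s))     ≈⟨ ~-digit 0 (ℕ.<⇒≤ 2≤q) _ ⟨
      shiftBy q (raise (wu s) s)                 ≈⟨ ~-shiftBy q (raise (wu s) s) ⟨
      raise (wu s) s                             ∎

    -- shift replaces θw + θu by θw + 2 θu.
    ~-raise-leading : ∀ s → s ~ raise (leading s) s
    ~-raise-leading s@(θ₀ ∷ θs@(θ₁ ∷ θ₂ ∷ θw ∷ θu ∷ [])) = begin
      s                                          ≈⟨ ~-shift s ⟩
      shift s                                    ≈⟨ ~-raise-wu (shift s) ⟩
      -- `shift` commutes with raising θ₀. The increment is split so that the part θw + θu can be
      -- removed again by `~-raise-wu`, leaving θu.
      raise (θw ℤ.+ θu ℤ.+ θu) (shift s)         ≡⟨ vec-≡ (commute θ₀ θ₁ θ₂ θw θu) refl refl refl ⟩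
      shift (raise (θw ℤ.+ θu) (raise θu s))     ≈⟨ ~-shift (raise (θw ℤ.+ θu) (raise θu s)) ⟨
      raise (θw ℤ.+ θu) (raise θu s)             ≈⟨ ~-raise-wu (raise θu s) ⟨
      raise θu s                                 ∎
      where
      open ℤ-Solver.+-*-Solver
      commute : ∀ θ₀ θ₁ θ₂ θw θu →
        θ₀ ℤ.+ θ₂ ℤ.+ θ₁ ℤ.+ (θw ℤ.+ θu ℤ.+ θu) ≡ θ₀ ℤ.+ θu ℤ.+ (θw ℤ.+ θu) ℤ.+ θ₂ ℤ.+ θ₁
      commute = solve 5 (λ θ₀ θ₁ θ₂ θw θu →
        θ₀ :+ θ₂ :+ θ₁ :+ (θw :+ θu :+ θu) := θ₀ :+ θu :+ (θw :+ θu) :+ θ₂ :+ θ₁) refl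

    ~-raise : ∀ k s → s ~ raise (leading s ℤ.* + k) s
    ~-raise zero    s@(θ₀ ∷ θ₁ ∷ θ₂ ∷ θw ∷ θu ∷ []) = begin
      s                            ≡⟨ vec-≡ (unchanged θ₀ θu) refl refl refl ⟨
      raise (θu ℤ.* 0ℤ) s          ∎
      where
      open ℤ-Solver.+-*-Solver
      unchanged : ∀ a b → a ℤ.+ b ℤ.* 0ℤ ≡ a
      unchanged = solve 2 (λ a b → a :+ b :* con 0ℤ := a) refl
    ~-raise (suc k) s@(θ₀ ∷ θ₁ ∷ θ₂ ∷ θw ∷ θu ∷ []) = begin
      s                                ≈⟨ ~-raise k s ⟩
      raise (θu ℤ.* + k) s             ≈⟨ ~-raise-leading (raise (θu ℤ.* + k) s) ⟩
      raise θu (raise (θu ℤ.* + k) s)  ≡⟨ vec-≡ (once-more θ₀ θu (+ k)) refl refl refl ⟩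
      raise (θu ℤ.* + suc k) s         ∎
      where
      open ℤ-Solver.+-*-Solver
      once-more : ∀ a b k → a ℤ.+ b ℤ.* k ℤ.+ b ≡ a ℤ.+ b ℤ.* (1ℤ ℤ.+ k)
      once-more = solve 3 (λ a b k → a :+ b :* k :+ b := a :+ b :* (con 1ℤ :+ k)) refl

    -- As `x` runs through ℤ/d, so does `leading s * x`. The `d` ratios with the correspondingly
    -- raised θ₀ add up to 1, and by `~-raise` each is asymptotic to `f s`; hence `d` times `f s`
    -- tends to 1.
    density : ∀ s → IsUnitMod d (leading s) → f s ⟶ fromℚ (+ 1 / d)
    density s leading-unit = null⇒⟶ {f s} (+ 1 / d)
      -- The threshold 1 excludes `n = 0`, where `Δ` vanishes by the default value of `ratio` but
      -- `f s 0 - 1 / d` does not.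
      (null-dominated {λ n → (+ 1 / d) * Δ n} 1
        (λ n 1≤n → ℚ.≤-reflexive (cong ∣_∣ (sym (average n 1≤n))))
        (null-*ˡ {Δ} (+ 1 / d) (null-sum {d} (λ i → null-difference (~-raise (toℕ i) s)))))
      where
      Δ : ℕ → ℚ
      Δ n = Σmod (λ x → f s n - f (raise (leading s ℤ.* x) s) n)
      Δ≡ : ∀ n .{{_ : NonZero n}} → Δ n ≡ ι d * f s n - 1ℚ
      Δ≡ n = trans (sum-− {d} (λ _ → f s n) _)
        (cong₂ _-_ (sum-const d (f s n)) (Σmod-f≡1 {leading s} leading-unit s n))
      open ℚ-Solver.+-*-Solver
      distrib : ∀ p e y → p * (e * y - 1ℚ) ≡ e * p * y - p
      distrib = solve 3 (λ p e y → p :* (e :* y :- con 1ℚ) := e :* p :* y :- p) refl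
      average : ∀ n → 1 ≤ n → (+ 1 / d) * Δ n ≡ f s n - + 1 / d
      average n@(suc _) _ =
        trans (cong ((+ 1 / d) *_) (Δ≡ n)) (trans (distrib (+ 1 / d) (ι d) (f s n))
          (cong (_- + 1 / d)
            (trans (cong (_* f s n) (ι-*-recip d)) (ℚ.*-identityˡ (f s n)))))

-- Uniform distribution modulo `d`

theorem4p4 : (q d : ℕ) .{{_ : NonZero d}} → 2 ≤ q → 2 ≤ d → Coprime q d →
    (∀ (s : Coefficients) → δ-Exists q d s) →
    (∀ (θu θw x : ℤ) → IsUnitMod d θu →
    δ q d ⟨ θu , θw , + 0 , + 0 , x ⟩ (fromℚ (+ 1 / d)))
    × UniformlyDistributedMod d (u q)
theorem4p4 q d 2≤q _ q⊥d δ-exists =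
  (λ θu θw x → density δ-exists (x ∷ 0ℤ ∷ 0ℤ ∷ θw ∷ θu ∷ [])) , uniform
  where
  open Density q d 2≤q q⊥d
  uniform : UniformlyDistributedMod d (u q)
  uniform c = ⟶-cong {f s} {L = fromℚ (+ 1 / d)}
    (ratio-count-cong (solution? q d (coefficients s)) (λ n → + u q n ≡? c [mod d ]) same)
    (density δ-exists s (Modulus.unit-1 d))
    where
    -- With these coefficients the form at `n` is `u q n - c`, so its zeros modulo `d` are the `n`
    -- at which `u q` meets the class of `c`; the leading coefficient 1 is a unit.
    s = ℤ.- c ∷ 0ℤ ∷ 0ℤ ∷ 0ℤ ∷ 1ℤ ∷ []
    open ℤ-Solver.+-*-Solver
    regroup : ∀ u w t n c →
      1ℤ ℤ.* u ℤ.+ 0ℤ ℤ.* w ℤ.+ 0ℤ ℤ.* t ℤ.+ 0ℤ ℤ.* n ℤ.+ (ℤ.- c) ℤ.- 0ℤ ≡ u ℤ.- c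
    regroup = solve 5 (λ u w t n c →
      con 1ℤ :* u :+ con 0ℤ :* w :+ con 0ℤ :* t :+ con 0ℤ :* n :+ (:- c) :- con 0ℤ := u :- c) refl
    form≡ : ∀ n → form q (coefficients s) n ℤ.- 0ℤ ≡ + u q n ℤ.- c
    form≡ n = regroup (+ u q n) (+ w q n) (+ triangle n) (+ n) c
    same : ∀ n → indicator (solution? q d (coefficients s) n) ≡ indicator (+ u q n ≡? c [mod d ])
    same n = indicator-cong (solution? q d (coefficients s) n) (+ u q n ≡? c [mod d ])
      (subst (+ d ∣_) (form≡ n)) (subst (+ d ∣_) (sym (form≡ n)))
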